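{- Let $a,b\ge1$ and $P=[a]\times[b]$. For $1\le i\le a$, with $B=\{i\}\times[b]$, we have $\sum_{p\in B}T_p^-\equiv^q q^{a-i}\frac{[b]_q}{[a+b]_q}$. For $1\le j\le b$, with $B=[a]\times\{j\}$, we have $\sum_{p\in B}T_p^-\equiv^q q^{b-j}\frac{[a]_q}{[a+b]_q}$.
   Context: $[a]\times[b]=\{(i,j)\colon1\le i\le a,1\le j\le b\}$ with $(i,j)\le(i',j')$ iff $i\le i'$ and $j\le j'$. $\mathcal{J}(P)$ is the set of order ideals. For $p\in P$, $I\in\mathcal{J}(P)$: $T_p^+(I)=1$ if $p$ is minimal in $P\setminus I$, else $0$; $T_p^-(I)=1$ if $p$ is maximal in $I$, else $0$; $T_p^q=T_p^+-qT_p^-$ with $q$ an indeterminate. For $f,g\colon\mathcal{J}(P)\to\mathbb{R}(q)$, $f\equiv^q g$ means $f-g=\sum_{p\in P}c_p(q)T_p^q$ for some $c_p(q)\in\mathbb{R}(q)$; an element of $\mathbb{R}(q)$ denotes a constant function. $[m]_q=1+q+\dots+q^{m-1}$. -}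

module Defs where

open import Algebra.Apartness.Bundles using (HeytingCommutativeRing; HeytingField)
open import Algebra.Apartness.Structures using (IsHeytingCommutativeRing; IsHeytingField)
open import Algebra.Bundles using (CommutativeRing)
open import Algebra.Definitions using (Invertible)
open import Algebra.Structures using (IsCommutativeRing)
open import Data.Bool.Base using (if_then_else_)
open import Data.Fin.Base using (Fin)
open import Data.List.Base using (List; []; _∷_; map; replicate)
open import Data.Nat.Base as ℕ using (ℕ; zero; suc)
open import Data.Product.Base using (∃; _×_; _,_; proj₁; proj₂; curry; uncurry)
open import Data.Product.Relation.Binary.Pointwise.NonDependent using (×-poset; ×-decidable)
open import Data.Sum.Base as Sum using (_⊎_; inj₁; inj₂)
open import Function.Base using (_∘_)
open import Level using (Level; 0ℓ; _⊔_)
open import Relation.Binary.Bundles using (Poset)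
open import Relation.Binary.PropositionalEquality as ≡ using (_≡_)
open import Relation.Nullary using (¬_; Dec; does; yes; no; contradiction; map′; ¬?; _×-dec_; _→-dec_)
open import Relation.Unary using (Pred; Decidable; ∁)
import Algebra.Apartness.Properties.HeytingCommutativeRing as HCR
import Algebra.Properties.CommutativeMonoid.Sum as Sums
import Algebra.Properties.Ring as RingProps
import Algebra.Properties.Semiring.Exp as Exp
import Algebra.Solver.Ring.NaturalCoefficients.Default as NatSolver
import Data.Fin.Properties as Fin
import Data.Nat.Properties as ℕ
import Relation.Binary.Reasoning.Setoid as SetoidReasoning

-- Real numbers as Cauchy sequences of rationals with a modulus of convergence;
-- sequences whose difference tends to 0 are identified by _≈_, and x # y says
-- that the two sequences are eventually separated by a positive rational.
module Reals where
  open import Data.Rational.Base as ℚ using (ℚ; 0ℚ; 1ℚ; ½; ∣_∣; _<_; _≤_; 1/_)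
  open import Data.Rational.Properties as ℚ using (_≟_; _<?_; module ≤-Reasoning)
  open import Data.Rational.Solver using (module +-*-Solver)
  open +-*-Solver using (solve; _:=_; _:+_; _:*_; _:-_; :-_; con)

  Eventually : (ℕ → Set) → Set
  Eventually P = ∃ λ N → ∀ n → N ℕ.≤ n → P n

  Cauchy : (ℕ → ℚ) → Set
  Cauchy s = ∀ ε → 0ℚ < ε → ∃ λ N → ∀ m n → N ℕ.≤ m → N ℕ.≤ n → ∣ s m ℚ.- s n ∣ < ε

  record ℝ : Set where
    no-eta-equality
    constructor mkℝ
    field
      seq    : ℕ → ℚ
      cauchy : Cauchy seq

  open ℝ

  infix 4 _≈_ _#_

  record _≈_ (x y : ℝ) : Set where
    constructor mk≈
    field null : ∀ ε → 0ℚ < ε → Eventually λ n → ∣ seq x n ℚ.- seq y n ∣ < ε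

  open _≈_

  record _#_ (x y : ℝ) : Set where
    constructor mk#
    field
      gap    : ℚ
      gap>0  : 0ℚ < gap
      beyond : Eventually λ n → gap < ∣ seq x n ℚ.- seq y n ∣

  private
    both : ∀ {P Q : ℕ → Set} → Eventually P → Eventually Q → Eventually (λ n → P n × Q n)
    both (M , p) (N , q) = M ℕ.⊔ N , λ n le →
      p n (ℕ.≤-trans (ℕ.m≤m⊔n M N) le) , q n (ℕ.≤-trans (ℕ.m≤n⊔m M N) le)

    first : ∀ L M N {n} → (L ℕ.⊔ M) ℕ.⊔ N ℕ.≤ n → L ℕ.≤ n
    first L M N le = ℕ.≤-trans (ℕ.m≤m⊔n L M) (ℕ.≤-trans (ℕ.m≤m⊔n (L ℕ.⊔ M) N) le)

    second : ∀ L M N {n} → (L ℕ.⊔ M) ℕ.⊔ N ℕ.≤ n → M ℕ.≤ n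
    second L M N le = ℕ.≤-trans (ℕ.m≤n⊔m L M) (ℕ.≤-trans (ℕ.m≤m⊔n (L ℕ.⊔ M) N) le)

    third : ∀ L M N {n} → (L ℕ.⊔ M) ℕ.⊔ N ℕ.≤ n → N ℕ.≤ n
    third L M N = ℕ.≤-trans (ℕ.m≤n⊔m (L ℕ.⊔ M) N)

    half>0 : ∀ {ε} → 0ℚ < ε → 0ℚ < ½ ℚ.* ε
    half>0 {ε} 0<ε = ≡.subst (_< ½ ℚ.* ε) (ℚ.*-zeroʳ ½) (ℚ.*-monoʳ-<-pos ½ 0<ε)

    half+half : ∀ ε → ½ ℚ.* ε ℚ.+ ½ ℚ.* ε ≡ ε
    half+half = solve 1 (λ e → con ½ :* e :+ con ½ :* e := e) ≡.refl

    half<whole : ∀ {δ} → 0ℚ < δ → ½ ℚ.* δ < δ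
    half<whole {δ} 0<δ = begin-strict
      ½ ℚ.* δ                ≡⟨ ℚ.+-identityʳ (½ ℚ.* δ) ⟨
      ½ ℚ.* δ ℚ.+ 0ℚ         <⟨ ℚ.+-monoʳ-< (½ ℚ.* δ) (half>0 0<δ) ⟩
      ½ ℚ.* δ ℚ.+ ½ ℚ.* δ    ≡⟨ half+half δ ⟩
      δ                      ∎
      where open ≤-Reasoning

    dist-sym : ∀ p q → ∣ p ℚ.- q ∣ ≡ ∣ q ℚ.- p ∣
    dist-sym p q = ≡.trans
      (≡.cong ∣_∣ (solve 2 (λ x y → x :- y := :- (y :- x)) ≡.refl p q))
      (ℚ.∣-p∣≡∣p∣ (q ℚ.- p))

    sum-small : ∀ {ε} p q → ∣ p ∣ < ½ ℚ.* ε → ∣ q ∣ < ½ ℚ.* ε → ∣ p ℚ.+ q ∣ < ε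
    sum-small {ε} p q p< q< = begin-strict
      ∣ p ℚ.+ q ∣              ≤⟨ ℚ.∣p+q∣≤∣p∣+∣q∣ p q ⟩
      ∣ p ∣ ℚ.+ ∣ q ∣          <⟨ ℚ.+-mono-< p< q< ⟩
      ½ ℚ.* ε ℚ.+ ½ ℚ.* ε      ≡⟨ half+half ε ⟩
      ε                        ∎
      where open ≤-Reasoning

    0<1 : 0ℚ < 1ℚ
    0<1 = ℚ.positive⁻¹ 1ℚ

    zero-small : ∀ {p ε} → p ≡ 0ℚ → 0ℚ < ε → ∣ p ∣ < ε
    zero-small ≡.refl 0<ε = 0<ε

    prod-small : ∀ {B δ η} p q → 0ℚ < B → B ℚ.* δ ≡ η → ∣ p ∣ < B → ∣ q ∣ < δ → ∣ p ℚ.* q ∣ < η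
    prod-small {B} {δ} {η} p q 0<B Bδ≡η p< q< = begin-strict
      ∣ p ℚ.* q ∣        ≡⟨ ℚ.∣p*q∣≡∣p∣*∣q∣ p q ⟩
      ∣ p ∣ ℚ.* ∣ q ∣    ≤⟨ ℚ.*-monoʳ-≤-nonNeg ∣ q ∣ {{ℚ.nonNegative (ℚ.0≤∣p∣ q)}} (ℚ.<⇒≤ p<) ⟩
      B ℚ.* ∣ q ∣        <⟨ ℚ.*-monoʳ-<-pos B {{ℚ.positive 0<B}} q< ⟩
      B ℚ.* δ            ≡⟨ Bδ≡η ⟩
      η                  ∎
      where open ≤-Reasoning

    divide : ∀ {B η} → 0ℚ < B → 0ℚ < η → ∃ λ δ → 0ℚ < δ × B ℚ.* δ ≡ η
    divide {B} {η} 0<B 0<η = B⁻¹ ℚ.* η , 0<δ , eq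
      where
      instance
        posB = ℚ.positive 0<B
        nzB  = ℚ.pos⇒nonZero B
        posB⁻¹ = ℚ.1/pos⇒pos B
      B⁻¹ = 1/ B
      0<δ : 0ℚ < B⁻¹ ℚ.* η
      0<δ = ≡.subst (_< B⁻¹ ℚ.* η) (ℚ.*-zeroʳ B⁻¹) (ℚ.*-monoʳ-<-pos B⁻¹ 0<η)
      eq : B ℚ.* (B⁻¹ ℚ.* η) ≡ η
      eq = ≡.trans (≡.sym (ℚ.*-assoc B B⁻¹ η))
             (≡.trans (≡.cong (ℚ._* η) (ℚ.*-inverseʳ B)) (ℚ.*-identityˡ η))

    near-bound : ∀ p q → ∣ p ℚ.- q ∣ < 1ℚ → ∣ p ∣ < ∣ q ∣ ℚ.+ 1ℚ
    near-bound p q pq< = begin-strict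
      ∣ p ∣                        ≡⟨ ≡.cong ∣_∣ (solve 2 (λ u v → u := v :+ (u :- v)) ≡.refl p q) ⟩
      ∣ q ℚ.+ (p ℚ.- q) ∣          ≤⟨ ℚ.∣p+q∣≤∣p∣+∣q∣ q (p ℚ.- q) ⟩
      ∣ q ∣ ℚ.+ ∣ p ℚ.- q ∣        <⟨ ℚ.+-monoʳ-< ∣ q ∣ pq< ⟩
      ∣ q ∣ ℚ.+ 1ℚ                 ∎
      where open ≤-Reasoning

    bounded : ∀ x → ∃ λ B → 0ℚ < B × Eventually (λ n → ∣ seq x n ∣ < B)
    bounded x = let N , close = cauchy x 1ℚ 0<1 in
      ∣ seq x N ∣ ℚ.+ 1ℚ , ℚ.+-mono-≤-< (ℚ.0≤∣p∣ (seq x N)) 0<1 ,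
      N , λ n N≤n → near-bound (seq x n) (seq x N) (close n N N≤n ℕ.≤-refl)

    product-close : ∀ {B C δ γ η} p q r s → 0ℚ < B → 0ℚ < C →
                    B ℚ.* δ ≡ ½ ℚ.* η → C ℚ.* γ ≡ ½ ℚ.* η →
                    ∣ p ∣ < B → ∣ s ∣ < C → ∣ p ℚ.- r ∣ < γ → ∣ q ℚ.- s ∣ < δ →
                    ∣ p ℚ.* q ℚ.- r ℚ.* s ∣ < η
    product-close {η = η} p q r s 0<B 0<C Bδ Cγ p< s< pr< qs< =
      ≡.subst (λ t → ∣ t ∣ < η)
        (solve 4 (λ p q r s → p :* (q :- s) :+ s :* (p :- r) := p :* q :- r :* s) ≡.refl p q r s)
        (sum-small (p ℚ.* (q ℚ.- s)) (s ℚ.* (p ℚ.- r))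
          (prod-small p (q ℚ.- s) 0<B Bδ p< qs<) (prod-small s (p ℚ.- r) 0<C Cγ s< pr<))

  fromℚ : ℚ → ℝ
  fromℚ p = mkℝ (λ _ → p) λ ε 0<ε → 0 , λ _ _ _ _ → zero-small (ℚ.+-inverseʳ p) 0<ε

  infixl 6 _+_ _-_
  infixl 7 _*_
  infix  8 -_

  _+_ : ℝ → ℝ → ℝ
  seq (x + y) n = seq x n ℚ.+ seq y n
  cauchy (x + y) ε 0<ε =
    let M , p = cauchy x (½ ℚ.* ε) (half>0 0<ε)
        N , q = cauchy y (½ ℚ.* ε) (half>0 0<ε)
    in M ℕ.⊔ N , λ m n lm ln →
      ≡.subst (λ t → ∣ t ∣ < ε)
        (solve 4 (λ a b c d → (a :- b) :+ (c :- d) := (a :+ c) :- (b :+ d)) ≡.refl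
          (seq x m) (seq x n) (seq y m) (seq y n))
        (sum-small (seq x m ℚ.- seq x n) (seq y m ℚ.- seq y n)
          (p m n (ℕ.≤-trans (ℕ.m≤m⊔n M N) lm) (ℕ.≤-trans (ℕ.m≤m⊔n M N) ln))
          (q m n (ℕ.≤-trans (ℕ.m≤n⊔m M N) lm) (ℕ.≤-trans (ℕ.m≤n⊔m M N) ln)))

  -_ : ℝ → ℝ
  seq (- x) n = ℚ.- seq x n
  cauchy (- x) ε 0<ε = let N , p = cauchy x ε 0<ε in N , λ m n lm ln →
    ≡.subst (λ t → ∣ t ∣ < ε)
      (solve 2 (λ a b → b :- a := (:- a) :- (:- b)) ≡.refl (seq x m) (seq x n)) (p n m ln lm)

  _-_ : ℝ → ℝ → ℝ
  x - y = x + (- y)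

  _*_ : ℝ → ℝ → ℝ
  seq (x * y) n = seq x n ℚ.* seq y n
  cauchy (x * y) ε 0<ε =
    let B , 0<B , xB = bounded x
        C , 0<C , yC = bounded y
        δ , 0<δ , Bδ = divide 0<B (half>0 0<ε)
        γ , 0<γ , Cγ = divide 0<C (half>0 0<ε)
        K , bnd = both xB yC
        M , p = cauchy x γ 0<γ
        N , q = cauchy y δ 0<δ
    in (M ℕ.⊔ N) ℕ.⊔ K , λ m n lm ln →
      product-close (seq x m) (seq y m) (seq x n) (seq y n) 0<B 0<C Bδ Cγ
        (proj₁ (bnd m (third M N K lm))) (proj₂ (bnd n (third M N K ln)))
        (p m n (first M N K lm) (first M N K ln)) (q m n (second M N K lm) (second M N K ln))

  private
    pointwise : ∀ {x y} → (∀ n → seq x n ≡ seq y n) → x ≈ y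
    pointwise {x} {y} eq = mk≈ λ ε 0<ε → 0 , λ n _ →
      zero-small (≡.trans (≡.cong (ℚ._- seq y n) (eq n)) (ℚ.+-inverseʳ (seq y n))) 0<ε

    ≈-refl : ∀ {x} → x ≈ x
    ≈-refl = pointwise λ _ → ≡.refl

    ≈-sym : ∀ {x y} → x ≈ y → y ≈ x
    ≈-sym {x} {y} x≈y = mk≈ λ ε 0<ε → let N , p = null x≈y ε 0<ε in
      N , λ n le → ≡.subst (_< ε) (dist-sym (seq x n) (seq y n)) (p n le)

    ≈-trans : ∀ {x y z} → x ≈ y → y ≈ z → x ≈ z
    ≈-trans {x} {y} {z} x≈y y≈z = mk≈ λ ε 0<ε →
      let N , p = both (null x≈y _ (half>0 0<ε)) (null y≈z _ (half>0 0<ε)) in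
      N , λ n le → ≡.subst (λ t → ∣ t ∣ < ε)
        (solve 3 (λ a b c → (a :- b) :+ (b :- c) := a :- c) ≡.refl (seq x n) (seq y n) (seq z n))
        (sum-small (seq x n ℚ.- seq y n) (seq y n ℚ.- seq z n) (proj₁ (p n le)) (proj₂ (p n le)))

    +-cong : ∀ {x y u v} → x ≈ y → u ≈ v → x + u ≈ y + v
    +-cong {x} {y} {u} {v} x≈y u≈v = mk≈ λ ε 0<ε →
      let N , p = both (null x≈y _ (half>0 0<ε)) (null u≈v _ (half>0 0<ε)) in
      N , λ n le → ≡.subst (λ t → ∣ t ∣ < ε)
        (solve 4 (λ a b c d → (a :- b) :+ (c :- d) := (a :+ c) :- (b :+ d)) ≡.refl
          (seq x n) (seq y n) (seq u n) (seq v n))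
        (sum-small (seq x n ℚ.- seq y n) (seq u n ℚ.- seq v n) (proj₁ (p n le)) (proj₂ (p n le)))

    -‿cong : ∀ {x y} → x ≈ y → - x ≈ - y
    -‿cong {x} {y} x≈y = mk≈ λ ε 0<ε → let N , p = null x≈y ε 0<ε in
      N , λ n le → ≡.subst (_< ε)
        (≡.trans (dist-sym (seq x n) (seq y n))
          (≡.cong ∣_∣ (solve 2 (λ a b → b :- a := (:- a) :- (:- b)) ≡.refl (seq x n) (seq y n))))
        (p n le)

    *-cong : ∀ {x y u v} → x ≈ y → u ≈ v → x * u ≈ y * v
    *-cong {x} {y} {u} {v} x≈y u≈v = mk≈ λ ε 0<ε →
      let B , 0<B , xB = bounded x
          C , 0<C , vC = bounded v
          δ , 0<δ , Bδ = divide 0<B (half>0 0<ε)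
          γ , 0<γ , Cγ = divide 0<C (half>0 0<ε)
          N , p = both (both xB vC) (both (null x≈y γ 0<γ) (null u≈v δ 0<δ))
      in N , λ n le → let (px , pv) , (pxy , puv) = p n le in
        product-close (seq x n) (seq u n) (seq y n) (seq v n) 0<B 0<C Bδ Cγ px pv pxy puv

  isCommutativeRing : IsCommutativeRing _≈_ _+_ _*_ -_ (fromℚ 0ℚ) (fromℚ 1ℚ)
  isCommutativeRing = record
    { isRing = record
      { +-isAbelianGroup = record
        { isGroup = record
          { isMonoid = record
            { isSemigroup = record
              { isMagma = record
                { isEquivalence = record { refl = ≈-refl ; sym = ≈-sym ; trans = ≈-trans }
                ; ∙-cong = +-cong }
              ; assoc = λ x y z → pointwise λ n → ℚ.+-assoc (seq x n) (seq y n) (seq z n) }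
            ; identity = (λ x → pointwise λ n → ℚ.+-identityˡ (seq x n))
                       , (λ x → pointwise λ n → ℚ.+-identityʳ (seq x n)) }
          ; inverse = (λ x → pointwise λ n → ℚ.+-inverseˡ (seq x n))
                    , (λ x → pointwise λ n → ℚ.+-inverseʳ (seq x n))
          ; ⁻¹-cong = -‿cong }
        ; comm = λ x y → pointwise λ n → ℚ.+-comm (seq x n) (seq y n) }
      ; *-cong = *-cong
      ; *-assoc = λ x y z → pointwise λ n → ℚ.*-assoc (seq x n) (seq y n) (seq z n)
      ; *-identity = (λ x → pointwise λ n → ℚ.*-identityˡ (seq x n))
                   , (λ x → pointwise λ n → ℚ.*-identityʳ (seq x n))
      ; distrib = (λ x y z → pointwise λ n → ℚ.*-distribˡ-+ (seq x n) (seq y n) (seq z n))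
                , (λ x y z → pointwise λ n → ℚ.*-distribʳ-+ (seq x n) (seq y n) (seq z n)) }
    ; *-comm = λ x y → pointwise λ n → ℚ.*-comm (seq x n) (seq y n) }

  private
    settled : ∀ {η} x y → 0ℚ < η → ∃ λ N → ∀ m n → N ℕ.≤ m → N ℕ.≤ n →
              ∣ (seq x m ℚ.- seq y m) ℚ.- (seq x n ℚ.- seq y n) ∣ < η
    settled x y 0<η = cauchy (x - y) _ 0<η

    persist : ∀ {η} p q → ∣ p ℚ.- q ∣ < ½ ℚ.* η → η < ∣ p ∣ → ½ ℚ.* η < ∣ q ∣
    persist {η} p q pq< η<p = ℚ.≰⇒> λ q≤ → ℚ.<-asym η<p (begin-strict
      ∣ p ∣                       ≡⟨ ≡.cong ∣_∣ (solve 2 (λ p q → p := (p :- q) :+ q) ≡.refl p q) ⟩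
      ∣ (p ℚ.- q) ℚ.+ q ∣         ≤⟨ ℚ.∣p+q∣≤∣p∣+∣q∣ (p ℚ.- q) q ⟩
      ∣ p ℚ.- q ∣ ℚ.+ ∣ q ∣       <⟨ ℚ.+-mono-<-≤ pq< q≤ ⟩
      ½ ℚ.* η ℚ.+ ½ ℚ.* η         ≡⟨ half+half η ⟩
      η                           ∎)
      where open ≤-Reasoning

    split : ∀ {g} p q r → g < ∣ p ℚ.- q ∣ → ½ ℚ.* g < ∣ p ℚ.- r ∣ ⊎ ½ ℚ.* g < ∣ r ℚ.- q ∣
    split {g} p q r g<pq with ½ ℚ.* g <? ∣ p ℚ.- r ∣
    ... | yes lt = inj₁ lt
    ... | no ≮ = inj₂ (ℚ.≰⇒> λ rq≤ → ℚ.<-irrefl ≡.refl (ℚ.<-≤-trans g<pq (begin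
      ∣ p ℚ.- q ∣
        ≡⟨ ≡.cong ∣_∣ (solve 3 (λ a b c → a :- c := (a :- b) :+ (b :- c)) ≡.refl p r q) ⟩
      ∣ (p ℚ.- r) ℚ.+ (r ℚ.- q) ∣
        ≤⟨ ℚ.∣p+q∣≤∣p∣+∣q∣ (p ℚ.- r) (r ℚ.- q) ⟩
      ∣ p ℚ.- r ∣ ℚ.+ ∣ r ℚ.- q ∣
        ≤⟨ ℚ.+-mono-≤ (ℚ.≮⇒≥ ≮) rq≤ ⟩
      ½ ℚ.* g ℚ.+ ½ ℚ.* g
        ≡⟨ half+half g ⟩
      g ∎)))
      where open ≤-Reasoning

    apart-from : ∀ {η} x y → 0ℚ < η → ∀ N →
                 (∀ m n → N ℕ.≤ m → N ℕ.≤ n →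
                   ∣ (seq x m ℚ.- seq y m) ℚ.- (seq x n ℚ.- seq y n) ∣ < ½ ℚ.* η) →
                 η < ∣ seq x N ℚ.- seq y N ∣ → x # y
    apart-from x y 0<η N close lt = mk# _ (half>0 0<η) (N , λ n le →
      persist (seq x N ℚ.- seq y N) (seq x n ℚ.- seq y n) (close N n ℕ.≤-refl le) lt)

    #-irrefl : ∀ {x y} → x ≈ y → ¬ x # y
    #-irrefl x≈y (mk# g 0<g gap) =
      let N , p = both (null x≈y g 0<g) gap
          small , big = p N ℕ.≤-refl
      in ℚ.<-asym small big

    #-sym : ∀ {x y} → x # y → y # x
    #-sym {x} {y} (mk# g 0<g (N , p)) = mk# g 0<g (N , λ n le →
      ≡.subst (g <_) (dist-sym (seq x n) (seq y n)) (p n le))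

    #-cotrans : ∀ {x y} → x # y → ∀ z → x # z ⊎ z # y
    #-cotrans {x} {y} (mk# g 0<g (K , gap)) z =
      let M , p = settled x z (half>0 (half>0 0<g))
          N , q = settled z y (half>0 (half>0 0<g))
          L = (M ℕ.⊔ N) ℕ.⊔ K
      in Sum.map
        (apart-from x z (half>0 0<g) L λ m n lm ln → p m n (first M N K lm) (first M N K ln))
        (apart-from z y (half>0 0<g) L λ m n lm ln → q m n (second M N K lm) (second M N K ln))
        (split (seq x L) (seq y L) (seq z L) (gap L (third M N K ℕ.≤-refl)))

    #-tight : ∀ {x y} → ¬ x # y → x ≈ y
    #-tight {x} {y} ¬x#y = mk≈ λ ε 0<ε →
      let N , close = settled x y (half>0 (half>0 0<ε)) in N , λ n le →
      ≡.subst (λ t → ∣ t ∣ < ε)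
        (solve 2 (λ u v → (u :- v) :+ v := u) ≡.refl (seq x n ℚ.- seq y n) (seq x N ℚ.- seq y N))
        (small (seq x n ℚ.- seq y n) (seq x N ℚ.- seq y N) (close n N le ℕ.≤-refl)
          (λ lt → ¬x#y (apart-from x y (half>0 0<ε) N close lt)) 0<ε)
      where
      open ≤-Reasoning
      small : ∀ {ε} p q → ∣ p ℚ.- q ∣ < ½ ℚ.* (½ ℚ.* ε) → ¬ (½ ℚ.* ε < ∣ q ∣) → 0ℚ < ε →
              ∣ (p ℚ.- q) ℚ.+ q ∣ < ε
      small {ε} p q pq< q≮ 0<ε = begin-strict
        ∣ (p ℚ.- q) ℚ.+ q ∣                          ≤⟨ ℚ.∣p+q∣≤∣p∣+∣q∣ (p ℚ.- q) q ⟩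
        ∣ p ℚ.- q ∣ ℚ.+ ∣ q ∣                        <⟨ ℚ.+-mono-<-≤ pq< (ℚ.≮⇒≥ q≮) ⟩
        ½ ℚ.* (½ ℚ.* ε) ℚ.+ ½ ℚ.* ε                  <⟨ ℚ.+-monoˡ-< (½ ℚ.* ε) (half<whole (half>0 0<ε)) ⟩
        ½ ℚ.* ε ℚ.+ ½ ℚ.* ε                          ≡⟨ half+half ε ⟩
        ε                                            ∎

    recip : ℚ → ℚ
    recip p with p ≟ 0ℚ
    ... | yes _  = 0ℚ
    ... | no p≢0 = (1/ p) {{ℚ.≢-nonZero p≢0}}

    recip-inverse : ∀ {g p} → 0ℚ < g → g < ∣ p ∣ → recip p ℚ.* p ≡ 1ℚ
    recip-inverse {g} {p} 0<g g<p with p ≟ 0ℚ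
    ... | yes ≡.refl = contradiction g<p (ℚ.<-asym 0<g)
    ... | no p≢0 = ℚ.*-inverseˡ p {{ℚ.≢-nonZero p≢0}}

    recip-bound : ∀ {g B p} → 0ℚ < g → 0ℚ < B → g ℚ.* B ≡ 1ℚ → g < ∣ p ∣ → ∣ recip p ∣ < B
    recip-bound {g} {B} {p} 0<g 0<B gB≡1 g<p = ℚ.≰⇒> λ B≤ → ℚ.<-irrefl ≡.refl (begin-strict
      1ℚ                    ≡⟨ gB≡1 ⟨
      g ℚ.* B               <⟨ ℚ.*-monoˡ-<-pos B {{ℚ.positive 0<B}} g<p ⟩
      ∣ p ∣ ℚ.* B           ≤⟨ ℚ.*-monoˡ-≤-nonNeg ∣ p ∣ {{ℚ.∣-∣-nonNeg p}} B≤ ⟩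
      ∣ p ∣ ℚ.* ∣ recip p ∣ ≡⟨ ℚ.∣p*q∣≡∣p∣*∣q∣ p (recip p) ⟨
      ∣ p ℚ.* recip p ∣     ≡⟨ ≡.cong ∣_∣ (≡.trans (ℚ.*-comm p (recip p)) (recip-inverse 0<g g<p)) ⟩
      1ℚ                    ∎)
      where open ≤-Reasoning

    recip-difference : ∀ p q r s → r ℚ.* p ≡ 1ℚ → s ℚ.* q ≡ 1ℚ → r ℚ.* (s ℚ.* (q ℚ.- p)) ≡ r ℚ.- s
    recip-difference p q r s rp sq = ≡.trans
      (solve 4 (λ p q r s → r :* (s :* (q :- p)) := r :* (s :* q) :- s :* (r :* p)) ≡.refl p q r s)
      (≡.cong₂ ℚ._-_ (≡.trans (≡.cong (r ℚ.*_) sq) (ℚ.*-identityʳ r))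
                     (≡.trans (≡.cong (s ℚ.*_) rp) (ℚ.*-identityʳ s)))

    inverse : ∀ z g → 0ℚ < g → Eventually (λ n → g < ∣ seq z n ∣) → ℝ
    seq (inverse z g 0<g away) n = recip (seq z n)
    cauchy (inverse z g 0<g (K , away)) ε 0<ε =
      let B , 0<B , gB≡1 = divide 0<g 0<1
          δ , 0<δ , Bδ = divide 0<B 0<ε
          γ , 0<γ , Bγ = divide 0<B 0<δ
          N , close = cauchy z γ 0<γ
      in N ℕ.⊔ K , λ m n lm ln →
        let gm = away m (ℕ.≤-trans (ℕ.m≤n⊔m N K) lm)
            gn = away n (ℕ.≤-trans (ℕ.m≤n⊔m N K) ln)
            p = seq z m ; q = seq z n
            r = recip p ; s = recip q
        in ≡.subst (λ t → ∣ t ∣ < ε)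
          (recip-difference p q r s (recip-inverse 0<g gm) (recip-inverse 0<g gn))
          (prod-small r (s ℚ.* (q ℚ.- p)) 0<B Bδ
            (recip-bound 0<g 0<B gB≡1 gm)
            (prod-small s (q ℚ.- p) 0<B Bγ (recip-bound 0<g 0<B gB≡1 gn)
              (close n m (ℕ.≤-trans (ℕ.m≤m⊔n N K) ln) (ℕ.≤-trans (ℕ.m≤m⊔n N K) lm))))

    inverse-correct : ∀ z g 0<g away → inverse z g 0<g away * z ≈ fromℚ 1ℚ
    inverse-correct z g 0<g (N , away) = mk≈ λ ε 0<ε → N , λ n le →
      zero-small (≡.trans (≡.cong (ℚ._- 1ℚ) (recip-inverse 0<g (away n le))) (ℚ.+-inverseʳ 1ℚ)) 0<ε

    unit-far : ∀ {B δ} w z → 0ℚ < B → B ℚ.* δ ≡ ½ ℚ.* 1ℚ → ∣ w ∣ < B →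
               ∣ w ℚ.* z ℚ.- 1ℚ ∣ < ½ ℚ.* 1ℚ → δ ≤ ∣ z ∣
    unit-far w z 0<B Bδ w< wz< = ℚ.≮⇒≥ λ z< → ℚ.<-irrefl ≡.refl
      (≡.subst (λ t → ∣ t ∣ < 1ℚ)
        (solve 1 (λ u → (:- (u :- con 1ℚ)) :+ u := con 1ℚ) ≡.refl (w ℚ.* z))
        (sum-small (ℚ.- (w ℚ.* z ℚ.- 1ℚ)) (w ℚ.* z)
          (≡.subst (_< ½ ℚ.* 1ℚ) (≡.sym (ℚ.∣-p∣≡∣p∣ (w ℚ.* z ℚ.- 1ℚ))) wz<)
          (prod-small w z 0<B Bδ w< z<)))

    invertible⇒apart : ∀ {x y} w → w * (x - y) ≈ fromℚ 1ℚ → x # y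
    invertible⇒apart {x} {y} w wz≈1 =
      let B , 0<B , wB = bounded w
          δ , 0<δ , Bδ = divide 0<B (half>0 0<1)
          N , p = both wB (null wz≈1 _ (half>0 0<1))
      in mk# (½ ℚ.* δ) (half>0 0<δ) (N , λ n le → ℚ.<-≤-trans (half<whole 0<δ)
           (unit-far (seq w n) (seq (x - y) n) 0<B Bδ (proj₁ (p n le)) (proj₂ (p n le))))

    apart⇒inverse : ∀ {x y} → x # y → ∃ λ w → w * (x - y) ≈ fromℚ 1ℚ
    apart⇒inverse {x} {y} (mk# g 0<g away) =
      inverse (x - y) g 0<g away , inverse-correct (x - y) g 0<g away

    *-comm : ∀ x y → x * y ≈ y * x
    *-comm x y = pointwise λ n → ℚ.*-comm (seq x n) (seq y n)

    apart⇒invertible : ∀ {x y} → x # y → Invertible _≈_ (fromℚ 1ℚ) _*_ (x - y)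
    apart⇒invertible {x} {y} x#y = let w , eq = apart⇒inverse x#y in
      w , eq , ≈-trans {(x - y) * w} {w * (x - y)} {fromℚ 1ℚ} (*-comm (x - y) w) eq

  isHeytingCommutativeRing : IsHeytingCommutativeRing _≈_ _#_ _+_ _*_ -_ (fromℚ 0ℚ) (fromℚ 1ℚ)
  isHeytingCommutativeRing = record
    { isCommutativeRing = isCommutativeRing
    ; isApartnessRelation = record { irrefl = #-irrefl ; sym = #-sym ; cotrans = #-cotrans }
    ; #⇒invertible = apart⇒invertible
    ; invertible⇒# = λ {x} {y} (w , eq , _) → invertible⇒apart {x} {y} w eq }

  ℝ-heytingField : HeytingField 0ℓ 0ℓ 0ℓ
  ℝ-heytingField = record
    { isHeytingField = record
      { isHeytingCommutativeRing = isHeytingCommutativeRing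
      ; tight = λ _ _ → #-tight , #-irrefl } }

-- K[q]: a polynomial is its list of coefficients, lowest degree first.  Trailing
-- zeros are allowed, so equality is _≈ₚ_ and not _≡_.
module Polynomials {c ℓ₁ ℓ₂ : Level} (K : HeytingField c ℓ₁ ℓ₂) where
  open HeytingField K hiding (zero) renaming (Carrier to A)
  open HeytingCommutativeRing heytingCommutativeRing using (commutativeRing)
  open CommutativeRing commutativeRing using (ring; commutativeSemiring)
  private
    module H = HCR heytingCommutativeRing
    module RP = RingProps ring
    module S = NatSolver commutativeSemiring
  open S using (solve; _:=_; _:+_; _:*_)
  open SetoidReasoning setoid

  Poly : Set c
  Poly = List A

  coeff : Poly → ℕ → A
  coeff []      _       = 0#
  coeff (a ∷ p) zero    = a
  coeff (a ∷ p) (suc n) = coeff p n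

  infix 4 _≈ₚ_

  record _≈ₚ_ (p r : Poly) : Set ℓ₁ where
    constructor mk≈ₚ
    field at : ∀ n → coeff p n ≈ coeff r n

  open _≈ₚ_

  infixl 6 _+ₚ_
  infixl 7 _·_ _*ₚ_
  infix  8 -ₚ_

  _+ₚ_ : Poly → Poly → Poly
  []      +ₚ r       = r
  (a ∷ p) +ₚ []      = a ∷ p
  (a ∷ p) +ₚ (b ∷ r) = (a + b) ∷ (p +ₚ r)

  -ₚ_ : Poly → Poly
  -ₚ p = map (λ a → - a) p

  _·_ : A → Poly → Poly
  a · p = map (a *_) p

  _*ₚ_ : Poly → Poly → Poly
  []      *ₚ r = []
  (a ∷ p) *ₚ r = a · r +ₚ (0# ∷ p *ₚ r)

  0ₚ 1ₚ X : Poly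
  0ₚ = []
  1ₚ = 1# ∷ []
  X  = 0# ∷ 1# ∷ []

  record Nonzero (p : Poly) : Set ℓ₂ where
    constructor mkNonzero
    field
      index   : ℕ
      coeff#0 : coeff p index # 0#

  coeff-+ : ∀ p r n → coeff (p +ₚ r) n ≈ coeff p n + coeff r n
  coeff-+ []      r       n       = sym (+-identityˡ _)
  coeff-+ (a ∷ p) []      n       = sym (+-identityʳ _)
  coeff-+ (a ∷ p) (b ∷ r) zero    = refl
  coeff-+ (a ∷ p) (b ∷ r) (suc n) = coeff-+ p r n

  coeff-neg : ∀ p n → coeff (-ₚ p) n ≈ - coeff p n
  coeff-neg []      n       = sym RP.-0#≈0#
  coeff-neg (a ∷ p) zero    = refl
  coeff-neg (a ∷ p) (suc n) = coeff-neg p n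

  coeff-· : ∀ a p n → coeff (a · p) n ≈ a * coeff p n
  coeff-· a []      n       = sym (zeroʳ a)
  coeff-· a (b ∷ p) zero    = refl
  coeff-· a (b ∷ p) (suc n) = coeff-· a p n

  private
    -- Cauchy product of coefficient sequences.
    conv : (ℕ → A) → (ℕ → A) → ℕ → A
    conv f g zero    = f 0 * g 0
    conv f g (suc n) = f 0 * g (suc n) + conv (f ∘ suc) g n

    conv-cong : ∀ {f f′ g g′} → (∀ n → f n ≈ f′ n) → (∀ n → g n ≈ g′ n) → ∀ n → conv f g n ≈ conv f′ g′ n
    conv-cong ff gg zero    = *-cong (ff 0) (gg 0)
    conv-cong ff gg (suc n) = +-cong (*-cong (ff 0) (gg (suc n))) (conv-cong (ff ∘ suc) gg n)

    conv-zero : ∀ g n → conv (λ _ → 0#) g n ≈ 0#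
    conv-zero g zero    = zeroˡ (g 0)
    conv-zero g (suc n) = trans (+-cong (zeroˡ _) (conv-zero g n)) (+-identityˡ 0#)

    conv-+ : ∀ f f′ g n → conv (λ k → f k + f′ k) g n ≈ conv f g n + conv f′ g n
    conv-+ f f′ g zero    = distribʳ (g 0) (f 0) (f′ 0)
    conv-+ f f′ g (suc n) = trans (+-congˡ (conv-+ (f ∘ suc) (f′ ∘ suc) g n))
      (solve 5 (λ a b c x y → (a :+ b) :* c :+ (x :+ y) := (a :* c :+ x) :+ (b :* c :+ y)) refl
        (f 0) (f′ 0) (g (suc n)) (conv (f ∘ suc) g n) (conv (f′ ∘ suc) g n))

    conv-scale : ∀ a f g n → conv (λ k → a * f k) g n ≈ a * conv f g n
    conv-scale a f g zero    = *-assoc a (f 0) (g 0)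
    conv-scale a f g (suc n) = trans (+-congˡ (conv-scale a (f ∘ suc) g n))
      (solve 4 (λ a b c d → a :* b :* c :+ a :* d := a :* (b :* c :+ d)) refl
        a (f 0) (g (suc n)) (conv (f ∘ suc) g n))

    conv-sucʳ : ∀ f g n → conv f g (suc n) ≈ conv f (g ∘ suc) n + f (suc n) * g 0
    conv-sucʳ f g zero    = refl
    conv-sucʳ f g (suc n) = trans (+-congˡ (conv-sucʳ (f ∘ suc) g n)) (sym (+-assoc _ _ _))

    conv-comm : ∀ f g n → conv f g n ≈ conv g f n
    conv-comm f g zero    = *-comm (f 0) (g 0)
    conv-comm f g (suc n) = begin
      f 0 * g (suc n) + conv (f ∘ suc) g n  ≈⟨ +-cong (*-comm _ _) (conv-comm (f ∘ suc) g n) ⟩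
      g (suc n) * f 0 + conv g (f ∘ suc) n  ≈⟨ +-comm _ _ ⟩
      conv g (f ∘ suc) n + g (suc n) * f 0  ≈⟨ conv-sucʳ g f n ⟨
      conv g f (suc n)                      ∎

    conv-assoc : ∀ f g h n → conv (conv f g) h n ≈ conv f (conv g h) n
    conv-assoc f g h zero    = *-assoc (f 0) (g 0) (h 0)
    conv-assoc f g h (suc n) = begin
      f 0 * g 0 * h (suc n) + conv (λ k → f 0 * g (suc k) + conv (f ∘ suc) g k) h n
        ≈⟨ +-congˡ (conv-+ (λ k → f 0 * g (suc k)) (conv (f ∘ suc) g) h n) ⟩
      f 0 * g 0 * h (suc n) + (conv (λ k → f 0 * g (suc k)) h n + conv (conv (f ∘ suc) g) h n)
        ≈⟨ +-congˡ (+-cong (conv-scale (f 0) (g ∘ suc) h n) (conv-assoc (f ∘ suc) g h n)) ⟩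
      f 0 * g 0 * h (suc n) + (f 0 * conv (g ∘ suc) h n + conv (f ∘ suc) (conv g h) n)
        ≈⟨ solve 5 (λ a b c d e → a :* b :* c :+ (a :* d :+ e) := a :* (b :* c :+ d) :+ e) refl
             (f 0) (g 0) (h (suc n)) (conv (g ∘ suc) h n) (conv (f ∘ suc) (conv g h) n) ⟩
      f 0 * (g 0 * h (suc n) + conv (g ∘ suc) h n) + conv (f ∘ suc) (conv g h) n ∎

    conv-one : ∀ g n → conv (coeff 1ₚ) g n ≈ g n
    conv-one g zero    = *-identityˡ (g 0)
    conv-one g (suc n) = trans (+-cong (*-identityˡ _) (conv-zero g n)) (+-identityʳ _)

    coeff-* : ∀ p r n → coeff (p *ₚ r) n ≈ conv (coeff p) (coeff r) n
    coeff-* []      r n       = sym (conv-zero (coeff r) n)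
    coeff-* (a ∷ p) r zero    =
      trans (coeff-+ (a · r) _ 0) (trans (+-identityʳ _) (coeff-· a r 0))
    coeff-* (a ∷ p) r (suc n) =
      trans (coeff-+ (a · r) _ (suc n)) (+-cong (coeff-· a r (suc n)) (coeff-* p r n))

    ≈ₚ-refl : ∀ {p} → p ≈ₚ p
    ≈ₚ-refl = mk≈ₚ λ _ → refl

    ≈ₚ-sym : ∀ {p r} → p ≈ₚ r → r ≈ₚ p
    ≈ₚ-sym e = mk≈ₚ λ n → sym (at e n)

    ≈ₚ-trans : ∀ {p r s} → p ≈ₚ r → r ≈ₚ s → p ≈ₚ s
    ≈ₚ-trans e e′ = mk≈ₚ λ n → trans (at e n) (at e′ n)

    +ₚ-cong : ∀ {p p′ r r′} → p ≈ₚ p′ → r ≈ₚ r′ → p +ₚ r ≈ₚ p′ +ₚ r′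
    +ₚ-cong {p} {p′} {r} {r′} e e′ = mk≈ₚ λ n →
      trans (coeff-+ p r n) (trans (+-cong (at e n) (at e′ n)) (sym (coeff-+ p′ r′ n)))

    +ₚ-assoc : ∀ p r s → (p +ₚ r) +ₚ s ≈ₚ p +ₚ (r +ₚ s)
    +ₚ-assoc p r s = mk≈ₚ λ n → begin
      coeff ((p +ₚ r) +ₚ s) n              ≈⟨ coeff-+ (p +ₚ r) s n ⟩
      coeff (p +ₚ r) n + coeff s n         ≈⟨ +-congʳ (coeff-+ p r n) ⟩
      coeff p n + coeff r n + coeff s n    ≈⟨ +-assoc _ _ _ ⟩
      coeff p n + (coeff r n + coeff s n)  ≈⟨ +-congˡ (coeff-+ r s n) ⟨
      coeff p n + coeff (r +ₚ s) n         ≈⟨ coeff-+ p (r +ₚ s) n ⟨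
      coeff (p +ₚ (r +ₚ s)) n              ∎

    +ₚ-comm : ∀ p r → p +ₚ r ≈ₚ r +ₚ p
    +ₚ-comm p r = mk≈ₚ λ n →
      trans (coeff-+ p r n) (trans (+-comm _ _) (sym (coeff-+ r p n)))

    +ₚ-identityʳ : ∀ p → p +ₚ 0ₚ ≈ₚ p
    +ₚ-identityʳ p = +ₚ-comm p 0ₚ

    -ₚ-cong : ∀ {p r} → p ≈ₚ r → -ₚ p ≈ₚ -ₚ r
    -ₚ-cong {p} {r} e = mk≈ₚ λ n →
      trans (coeff-neg p n) (trans (-‿cong (at e n)) (sym (coeff-neg r n)))

    -ₚ-inverseˡ : ∀ p → -ₚ p +ₚ p ≈ₚ 0ₚ
    -ₚ-inverseˡ p = mk≈ₚ λ n →
      trans (coeff-+ (-ₚ p) p n) (trans (+-congʳ (coeff-neg p n)) (-‿inverseˡ _))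

    *ₚ-cong : ∀ {p p′ r r′} → p ≈ₚ p′ → r ≈ₚ r′ → p *ₚ r ≈ₚ p′ *ₚ r′
    *ₚ-cong {p} {p′} {r} {r′} e e′ = mk≈ₚ λ n →
      trans (coeff-* p r n) (trans (conv-cong (at e) (at e′) n) (sym (coeff-* p′ r′ n)))

    *ₚ-comm : ∀ p r → p *ₚ r ≈ₚ r *ₚ p
    *ₚ-comm p r = mk≈ₚ λ n →
      trans (coeff-* p r n) (trans (conv-comm (coeff p) (coeff r) n) (sym (coeff-* r p n)))

    *ₚ-assoc : ∀ p r s → (p *ₚ r) *ₚ s ≈ₚ p *ₚ (r *ₚ s)
    *ₚ-assoc p r s = mk≈ₚ λ n → begin
      coeff ((p *ₚ r) *ₚ s) n                      ≈⟨ coeff-* (p *ₚ r) s n ⟩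
      conv (coeff (p *ₚ r)) (coeff s) n            ≈⟨ conv-cong (coeff-* p r) (λ _ → refl) n ⟩
      conv (conv (coeff p) (coeff r)) (coeff s) n  ≈⟨ conv-assoc (coeff p) (coeff r) (coeff s) n ⟩
      conv (coeff p) (conv (coeff r) (coeff s)) n  ≈⟨ conv-cong (λ _ → refl) (coeff-* r s) n ⟨
      conv (coeff p) (coeff (r *ₚ s)) n            ≈⟨ coeff-* p (r *ₚ s) n ⟨
      coeff (p *ₚ (r *ₚ s)) n                      ∎

    *ₚ-identityˡ : ∀ p → 1ₚ *ₚ p ≈ₚ p
    *ₚ-identityˡ p = mk≈ₚ λ n → trans (coeff-* 1ₚ p n) (conv-one (coeff p) n)

    *ₚ-distribʳ : ∀ s p r → (p +ₚ r) *ₚ s ≈ₚ p *ₚ s +ₚ r *ₚ s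
    *ₚ-distribʳ s p r = mk≈ₚ λ n → begin
      coeff ((p +ₚ r) *ₚ s) n                             ≈⟨ coeff-* (p +ₚ r) s n ⟩
      conv (coeff (p +ₚ r)) (coeff s) n                   ≈⟨ conv-cong (coeff-+ p r) (λ _ → refl) n ⟩
      conv (λ k → coeff p k + coeff r k) (coeff s) n      ≈⟨ conv-+ (coeff p) (coeff r) (coeff s) n ⟩
      conv (coeff p) (coeff s) n + conv (coeff r) (coeff s) n
        ≈⟨ +-cong (coeff-* p s n) (coeff-* r s n) ⟨
      coeff (p *ₚ s) n + coeff (r *ₚ s) n                 ≈⟨ coeff-+ (p *ₚ s) (r *ₚ s) n ⟨
      coeff (p *ₚ s +ₚ r *ₚ s) n                          ∎

  polynomialRing : CommutativeRing c ℓ₁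
  polynomialRing = record
    { Carrier = Poly ; _≈_ = _≈ₚ_ ; _+_ = _+ₚ_ ; _*_ = _*ₚ_ ; -_ = -ₚ_ ; 0# = 0ₚ ; 1# = 1ₚ
    ; isCommutativeRing = record
      { isRing = record
        { +-isAbelianGroup = record
          { isGroup = record
            { isMonoid = record
              { isSemigroup = record
                { isMagma = record
                  { isEquivalence = record { refl = ≈ₚ-refl ; sym = ≈ₚ-sym ; trans = ≈ₚ-trans }
                  ; ∙-cong = +ₚ-cong }
                ; assoc = +ₚ-assoc }
              ; identity = (λ _ → ≈ₚ-refl) , +ₚ-identityʳ }
            ; inverse = -ₚ-inverseˡ , λ p → ≈ₚ-trans (+ₚ-comm p (-ₚ p)) (-ₚ-inverseˡ p)
            ; ⁻¹-cong = -ₚ-cong }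
          ; comm = +ₚ-comm }
        ; *-cong = *ₚ-cong
        ; *-assoc = *ₚ-assoc
        ; *-identity = *ₚ-identityˡ , λ p → ≈ₚ-trans (*ₚ-comm p 1ₚ) (*ₚ-identityˡ p)
        ; distrib = (λ s p r → ≈ₚ-trans (*ₚ-comm s (p +ₚ r)) (≈ₚ-trans (*ₚ-distribʳ s p r)
                      (+ₚ-cong (*ₚ-comm p s) (*ₚ-comm r s))))
                  , *ₚ-distribʳ }
      ; *-comm = *ₚ-comm } }

  private
    summand#0 : ∀ x y → y # 0# → (x + y # 0#) ⊎ (x # 0#)
    summand#0 x y y#0 with #-cotrans y#0 (x + y)
    ... | inj₂ x+y#0 = inj₁ x+y#0
    ... | inj₁ y#x+y = let w , w[x+y-y]≈1 , _ = #⇒invertible (#-sym y#x+y) in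
      inj₂ (H.invertibleˡ⇒# (w , trans (*-congˡ x-0≈x+y-y) w[x+y-y]≈1))
      where
      x-0≈x+y-y : x - 0# ≈ (x + y) - y
      x-0≈x+y-y = begin
        x - 0#          ≈⟨ H.x-0≈x x ⟩
        x               ≈⟨ +-identityʳ x ⟨
        x + 0#          ≈⟨ +-congˡ (-‿inverseʳ y) ⟨
        x + (y - y)     ≈⟨ +-assoc x y (- y) ⟨
        (x + y) - y     ∎

    factor#0 : ∀ x y → x * y # 0# → x # 0#
    factor#0 x y xy#0 = let w , w[xy-0]≈1 , _ = #⇒invertible xy#0 in
      H.invertibleˡ⇒# (w * y , (begin
        w * y * (x - 0#)    ≈⟨ *-congˡ (H.x-0≈x x) ⟩
        w * y * x           ≈⟨ solve 3 (λ w y x → w :* y :* x := w :* (x :* y)) refl w y x ⟩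
        w * (x * y)         ≈⟨ *-congˡ (H.x-0≈x (x * y)) ⟨
        w * (x * y - 0#)    ≈⟨ w[xy-0]≈1 ⟩
        1#                  ∎))

    conv#0 : ∀ i j f g → f i # 0# → g j # 0# → ∃ λ n → conv f g n # 0#
    conv#0 zero zero f g f#0 g#0 = 0 , H.x#0y#0→xy#0 f#0 g#0
    conv#0 zero (suc j) f g f#0 g#0 with conv#0 zero j f (g ∘ suc) f#0 g#0
    ... | n , c#0 with summand#0 (f (suc n) * g 0) (conv f (g ∘ suc) n) c#0
    ... | inj₁ s#0 = suc n , H.#-congʳ (trans (+-comm _ _) (sym (conv-sucʳ f g n))) s#0
    ... | inj₂ fg#0 = 0 , H.x#0y#0→xy#0 f#0
                        (factor#0 (g 0) (f (suc n)) (H.#-congʳ (*-comm _ _) fg#0))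
    conv#0 (suc i) j f g f#0 g#0 with conv#0 i j (f ∘ suc) g f#0 g#0
    ... | n , c#0 with summand#0 (f 0 * g (suc n)) (conv (f ∘ suc) g n) c#0
    ... | inj₁ s#0 = suc n , s#0
    ... | inj₂ fg#0 = conv#0 zero j f g (factor#0 (f 0) (g (suc n)) fg#0) g#0

  1ₚ-nonzero : Nonzero 1ₚ
  1ₚ-nonzero = mkNonzero 0 H.1#0

  *ₚ-nonzero : ∀ {p r} → Nonzero p → Nonzero r → Nonzero (p *ₚ r)
  *ₚ-nonzero {p} {r} (mkNonzero i p#0) (mkNonzero j r#0) =
    let n , c#0 = conv#0 i j (coeff p) (coeff r) p#0 r#0 in
    mkNonzero n (H.#-congʳ (sym (coeff-* p r n)) c#0)

  -- Domain property: tightness of # turns non-apartness of each coefficient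
  -- of p from 0# into equality.
  *ₚ-zero-divisor : ∀ {d p} → Nonzero d → d *ₚ p ≈ₚ 0ₚ → p ≈ₚ 0ₚ
  *ₚ-zero-divisor {d} {p} d≠0 dp≈0 = mk≈ₚ λ n → proj₁ (tight (coeff p n) 0#) λ p#0 →
    let mkNonzero k dp#0 = *ₚ-nonzero d≠0 (mkNonzero n p#0) in
    #-irrefl (at dp≈0 k) dp#0

-- K(q): fractions of polynomials whose denominator has some coefficient apart
-- from 0, with equality by cross-multiplication.
module RationalFunctions {c ℓ₁ ℓ₂ : Level} (K : HeytingField c ℓ₁ ℓ₂) where
  open Polynomials K
  private
    module R = CommutativeRing polynomialRing
    module RP = RingProps R.ring
    module S = NatSolver R.commutativeSemiring
  open S using (solve; _:=_; _:+_; _:*_)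
  open SetoidReasoning R.setoid

  record Fraction : Set (c ⊔ ℓ₂) where
    constructor mkFraction
    field
      num den     : Poly
      den-nonzero : Nonzero den

  open Fraction

  infixl 7 _/_
  _/_ : (p r : Poly) → {{Nonzero r}} → Fraction
  _/_ p r {{r≠0}} = mkFraction p r r≠0

  fromPoly : Poly → Fraction
  fromPoly p = mkFraction p 1ₚ 1ₚ-nonzero

  infix 4 _≃_

  record _≃_ (x y : Fraction) : Set ℓ₁ where
    constructor mk≃
    field cross : num x *ₚ den y ≈ₚ num y *ₚ den x

  open _≃_

  infixl 6 _⊞_
  infixl 7 _⊠_
  infix  8 ⊟_

  _⊞_ _⊠_ : Fraction → Fraction → Fraction
  mkFraction a b b≠0 ⊞ mkFraction c d d≠0 = mkFraction (a *ₚ d +ₚ c *ₚ b) (b *ₚ d) (*ₚ-nonzero b≠0 d≠0)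
  mkFraction a b b≠0 ⊠ mkFraction c d d≠0 = mkFraction (a *ₚ c) (b *ₚ d) (*ₚ-nonzero b≠0 d≠0)

  ⊟_ : Fraction → Fraction
  ⊟ mkFraction a b b≠0 = mkFraction (-ₚ a) b b≠0

  private
    cancel : ∀ {d p r} → Nonzero d → d *ₚ p ≈ₚ d *ₚ r → p ≈ₚ r
    cancel {d} {p} {r} d≠0 dp≈dr = RP.x∙y⁻¹≈ε⇒x≈y p r (*ₚ-zero-divisor d≠0 (begin
      d *ₚ (p +ₚ -ₚ r)          ≈⟨ R.distribˡ d p (-ₚ r) ⟩
      d *ₚ p +ₚ d *ₚ (-ₚ r)     ≈⟨ R.+-cong dp≈dr (R.sym (RP.-‿distribʳ-* d r)) ⟩
      d *ₚ r +ₚ -ₚ (d *ₚ r)     ≈⟨ R.-‿inverseʳ (d *ₚ r) ⟩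
      0ₚ                        ∎))

    ≃-trans : ∀ {x y z} → x ≃ y → y ≃ z → x ≃ z
    ≃-trans {mkFraction a b _} {mkFraction c d d≠0} {mkFraction e f _} (mk≃ ad≈cb) (mk≃ cf≈ed) =
      mk≃ (cancel d≠0 (begin
        d *ₚ (a *ₚ f)    ≈⟨ solve 3 (λ d a f → d :* (a :* f) := (a :* d) :* f) R.refl d a f ⟩
        (a *ₚ d) *ₚ f    ≈⟨ R.*-congʳ ad≈cb ⟩
        (c *ₚ b) *ₚ f    ≈⟨ solve 3 (λ c b f → (c :* b) :* f := (c :* f) :* b) R.refl c b f ⟩
        (c *ₚ f) *ₚ b    ≈⟨ R.*-congʳ cf≈ed ⟩
        (e *ₚ d) *ₚ b    ≈⟨ solve 3 (λ e d b → (e :* d) :* b := d :* (e :* b)) R.refl e d b ⟩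
        d *ₚ (e *ₚ b)    ∎))

    ⊞-cong : ∀ {x x′ y y′} → x ≃ x′ → y ≃ y′ → x ⊞ y ≃ x′ ⊞ y′
    ⊞-cong {mkFraction a b _} {mkFraction a′ b′ _} {mkFraction c d _} {mkFraction c′ d′ _}
           (mk≃ e) (mk≃ e′) = mk≃ (begin
      (a *ₚ d +ₚ c *ₚ b) *ₚ (b′ *ₚ d′)
        ≈⟨ solve 6 (λ a b c d b′ d′ → (a :* d :+ c :* b) :* (b′ :* d′)
             := (a :* b′) :* (d :* d′) :+ (c :* d′) :* (b :* b′)) R.refl a b c d b′ d′ ⟩
      (a *ₚ b′) *ₚ (d *ₚ d′) +ₚ (c *ₚ d′) *ₚ (b *ₚ b′)
        ≈⟨ R.+-cong (R.*-congʳ e) (R.*-congʳ e′) ⟩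
      (a′ *ₚ b) *ₚ (d *ₚ d′) +ₚ (c′ *ₚ d) *ₚ (b *ₚ b′)
        ≈⟨ solve 6 (λ a′ b c′ d b′ d′ → (a′ :* b) :* (d :* d′) :+ (c′ :* d) :* (b :* b′)
             := (a′ :* d′ :+ c′ :* b′) :* (b :* d)) R.refl a′ b c′ d b′ d′ ⟩
      (a′ *ₚ d′ +ₚ c′ *ₚ b′) *ₚ (b *ₚ d) ∎)

    ⊠-cong : ∀ {x x′ y y′} → x ≃ x′ → y ≃ y′ → x ⊠ y ≃ x′ ⊠ y′
    ⊠-cong {mkFraction a b _} {mkFraction a′ b′ _} {mkFraction c d _} {mkFraction c′ d′ _}
           (mk≃ e) (mk≃ e′) = mk≃ (begin
      (a *ₚ c) *ₚ (b′ *ₚ d′)   ≈⟨ interchange a c b′ d′ ⟩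
      (a *ₚ b′) *ₚ (c *ₚ d′)   ≈⟨ R.*-cong e e′ ⟩
      (a′ *ₚ b) *ₚ (c′ *ₚ d)   ≈⟨ interchange a′ b c′ d ⟩
      (a′ *ₚ c′) *ₚ (b *ₚ d)   ∎)
      where
      interchange : ∀ p r s t → (p *ₚ r) *ₚ (s *ₚ t) ≈ₚ (p *ₚ s) *ₚ (r *ₚ t)
      interchange = solve 4 (λ p r s t → (p :* r) :* (s :* t) := (p :* s) :* (r :* t)) R.refl

    ⊟-cong : ∀ {x x′} → x ≃ x′ → ⊟ x ≃ ⊟ x′
    ⊟-cong {mkFraction a b _} {mkFraction a′ b′ _} (mk≃ e) = mk≃ (begin
      -ₚ a *ₚ b′      ≈⟨ RP.-‿distribˡ-* a b′ ⟨
      -ₚ (a *ₚ b′)    ≈⟨ R.-‿cong e ⟩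
      -ₚ (a′ *ₚ b)    ≈⟨ RP.-‿distribˡ-* a′ b ⟩
      -ₚ a′ *ₚ b      ∎)

    ⊞-comm : ∀ x y → x ⊞ y ≃ y ⊞ x
    ⊞-comm (mkFraction a b _) (mkFraction c d _) = mk≃
      (solve 4 (λ a b c d → (a :* d :+ c :* b) :* (d :* b) := (c :* b :+ a :* d) :* (b :* d)) R.refl a b c d)

    ⊞-assoc : ∀ x y z → (x ⊞ y) ⊞ z ≃ x ⊞ (y ⊞ z)
    ⊞-assoc (mkFraction a b _) (mkFraction c d _) (mkFraction e f _) = mk≃
      (solve 6 (λ a b c d e f →
        ((a :* d :+ c :* b) :* f :+ e :* (b :* d)) :* (b :* (d :* f)) :=
        (a :* (d :* f) :+ (c :* f :+ e :* d) :* b) :* ((b :* d) :* f)) R.refl a b c d e f)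

    ⊞-identityˡ : ∀ x → fromPoly 0ₚ ⊞ x ≃ x
    ⊞-identityˡ (mkFraction a b _) = mk≃ (begin
      (0ₚ *ₚ b +ₚ a *ₚ 1ₚ) *ₚ b
        ≈⟨ R.*-congʳ (R.trans (R.+-congʳ (R.zeroˡ b)) (R.+-identityˡ (a *ₚ 1ₚ))) ⟩
      (a *ₚ 1ₚ) *ₚ b    ≈⟨ R.*-assoc a 1ₚ b ⟩
      a *ₚ (1ₚ *ₚ b)    ∎)

    ⊟-inverseˡ : ∀ x → ⊟ x ⊞ x ≃ fromPoly 0ₚ
    ⊟-inverseˡ (mkFraction a b _) = mk≃ (begin
      (-ₚ a *ₚ b +ₚ a *ₚ b) *ₚ 1ₚ   ≈⟨ R.*-identityʳ _ ⟩
      -ₚ a *ₚ b +ₚ a *ₚ b           ≈⟨ R.distribʳ b (-ₚ a) a ⟨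
      (-ₚ a +ₚ a) *ₚ b              ≈⟨ R.*-congʳ (R.-‿inverseˡ a) ⟩
      0ₚ *ₚ b                       ≈⟨ R.zeroˡ b ⟩
      0ₚ                            ≈⟨ R.zeroˡ (b *ₚ b) ⟨
      0ₚ *ₚ (b *ₚ b)                ∎)

    ⊠-comm : ∀ x y → x ⊠ y ≃ y ⊠ x
    ⊠-comm (mkFraction a b _) (mkFraction c d _) = mk≃
      (solve 4 (λ a b c d → (a :* c) :* (d :* b) := (c :* a) :* (b :* d)) R.refl a b c d)

    ⊠-assoc : ∀ x y z → (x ⊠ y) ⊠ z ≃ x ⊠ (y ⊠ z)
    ⊠-assoc (mkFraction a b _) (mkFraction c d _) (mkFraction e f _) = mk≃
      (solve 6 (λ a b c d e f → ((a :* c) :* e) :* (b :* (d :* f)) := (a :* (c :* e)) :* ((b :* d) :* f))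
        R.refl a b c d e f)

    ⊠-identityˡ : ∀ x → fromPoly 1ₚ ⊠ x ≃ x
    ⊠-identityˡ (mkFraction a b _) = mk≃ (R.trans
      (R.*-congʳ (R.*-identityˡ a)) (R.*-congˡ {a} (R.sym (R.*-identityˡ b))))

    ⊠-distribʳ : ∀ z x y → (x ⊞ y) ⊠ z ≃ (x ⊠ z) ⊞ (y ⊠ z)
    ⊠-distribʳ (mkFraction e f _) (mkFraction a b _) (mkFraction c d _) = mk≃
      (solve 6 (λ a b c d e f →
        ((a :* d :+ c :* b) :* e) :* ((b :* f) :* (d :* f)) :=
        ((a :* e) :* (d :* f) :+ (c :* e) :* (b :* f)) :* ((b :* d) :* f)) R.refl a b c d e f)

  rationalFunctionRing : CommutativeRing (c ⊔ ℓ₂) ℓ₁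
  rationalFunctionRing = record
    { Carrier = Fraction ; _≈_ = _≃_ ; _+_ = _⊞_ ; _*_ = _⊠_ ; -_ = ⊟_
    ; 0# = fromPoly 0ₚ ; 1# = fromPoly 1ₚ
    ; isCommutativeRing = record
      { isRing = record
        { +-isAbelianGroup = record
          { isGroup = record
            { isMonoid = record
              { isSemigroup = record
                { isMagma = record
                  { isEquivalence = record
                    { refl = mk≃ R.refl ; sym = λ e → mk≃ (R.sym (cross e)) ; trans = ≃-trans }
                  ; ∙-cong = ⊞-cong }
                ; assoc = ⊞-assoc }
              ; identity = ⊞-identityˡ , λ x → ≃-trans (⊞-comm x (fromPoly 0ₚ)) (⊞-identityˡ x) }
            ; inverse = ⊟-inverseˡ , λ x → ≃-trans (⊞-comm x (⊟ x)) (⊟-inverseˡ x)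
            ; ⁻¹-cong = ⊟-cong }
          ; comm = ⊞-comm }
        ; *-cong = ⊠-cong
        ; *-assoc = ⊠-assoc
        ; *-identity = ⊠-identityˡ , λ x → ≃-trans (⊠-comm x (fromPoly 1ₚ)) (⊠-identityˡ x)
        ; distrib = (λ z x y → ≃-trans (⊠-comm z (x ⊞ y)) (≃-trans (⊠-distribʳ z x y)
                      (⊞-cong (⊠-comm x z) (⊠-comm y z))))
                  , ⊠-distribʳ }
      ; *-comm = ⊠-comm } }

open Reals using (ℝ-heytingField)
open Polynomials ℝ-heytingField using (Poly; Nonzero; mkNonzero; X)
open RationalFunctions ℝ-heytingField using (fromPoly; _/_; rationalFunctionRing) public

ℝ⟨q⟩ : CommutativeRing 0ℓ 0ℓ
ℝ⟨q⟩ = rationalFunctionRing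

module ℝ⟨q⟩ where
  open CommutativeRing ℝ⟨q⟩ public
  open Exp semiring using (_^_) public
  open Sums +-commutativeMonoid using (sum; sum-syntax) public

open ℝ⟨q⟩ using (_^_; sum-syntax) public

q : ℝ⟨q⟩.Carrier
q = fromPoly X

-- 1 + q + ⋯ + q^(m-1), as the list of its m coefficients.
[_]q : ℕ → Poly
[ m ]q = replicate m (HeytingField.1# ℝ-heytingField)

instance
  []q-nonzero : ∀ {m} .{{_ : ℕ.NonZero m}} → Nonzero [ m ]q
  []q-nonzero {suc m} = mkNonzero 0 (HCR.1#0 (HeytingField.heytingCommutativeRing ℝ-heytingField))

  +-nonZero : ∀ {m n} .{{_ : ℕ.NonZero m}} → ℕ.NonZero (m ℕ.+ n)
  +-nonZero {suc m} = _

module _ (P : Poset 0ℓ 0ℓ 0ℓ) where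
  open Poset P

  -- Membership is decidable, as it is for every subset of a finite set
  -- classically; T⁺ and T⁻ are defined by cases on it.
  record OrderIdeal : Set₁ where
    field
      member  : Pred Carrier 0ℓ
      member? : Decidable member
      closed  : ∀ {x y} → x ≤ y → member y → member x

  Minimal : Pred Carrier 0ℓ → Pred Carrier 0ℓ
  Minimal S p = S p × (∀ r → S r → r ≤ p → r ≈ p)

  Maximal : Pred Carrier 0ℓ → Pred Carrier 0ℓ
  Maximal S p = S p × (∀ r → S r → p ≤ r → p ≈ r)

-- The index k : Fin n stands for the element toℕ k + 1 of [n].
[_]×[_] : ℕ → ℕ → Poset 0ℓ 0ℓ 0ℓ
[ a ]×[ b ] = ×-poset (Fin.≤-poset a) (Fin.≤-poset b)

module Toggleability (a b : ℕ) where
  P : Poset 0ℓ 0ℓ 0ℓ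
  P = [ a ]×[ b ]

  private module P = Poset P

  ∀? : ∀ {S : Pred P.Carrier 0ℓ} → Decidable S → Dec (∀ p → S p)
  ∀? S? = map′ uncurry curry (Fin.all? λ i → Fin.all? λ j → S? (i , j))

  _≤?_ : ∀ p r → Dec (p P.≤ r)
  _≤?_ = ×-decidable Fin._≤?_ Fin._≤?_

  _≈?_ : ∀ p r → Dec (p P.≈ r)
  _≈?_ = ×-decidable Fin._≟_ Fin._≟_

  indicator : ∀ {A : Set} → Dec A → ℝ⟨q⟩.Carrier
  indicator A? = if does A? then ℝ⟨q⟩.1# else ℝ⟨q⟩.0#

  𝓙 : Set₁
  𝓙 = OrderIdeal P

  open OrderIdeal

  minimal? : ∀ {S} → Decidable S → Decidable (Minimal P S)
  minimal? S? p = S? p ×-dec ∀? λ r → S? r →-dec (r ≤? p →-dec r ≈? p)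

  maximal? : ∀ {S} → Decidable S → Decidable (Maximal P S)
  maximal? S? p = S? p ×-dec ∀? λ r → S? r →-dec (p ≤? r →-dec p ≈? r)

  T⁺ T⁻ Tq : P.Carrier → 𝓙 → ℝ⟨q⟩.Carrier
  T⁺ p I = indicator (minimal? {∁ (member I)} (¬? ∘ member? I) p)
  T⁻ p I = indicator (maximal? (member? I) p)
  Tq p I = T⁺ p I ℝ⟨q⟩.- q ℝ⟨q⟩.* T⁻ p I

  infix 4 _≡q_

  _≡q_ : (f g : 𝓙 → ℝ⟨q⟩.Carrier) → Set₁
  f ≡q g = ∃ λ (c : P.Carrier → ℝ⟨q⟩.Carrier) → ∀ I →
    f I ℝ⟨q⟩.- g I ℝ⟨q⟩.≈ ∑[ i < a ] (∑[ j < b ] (c (i , j) ℝ⟨q⟩.* Tq (i , j) I))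

{-# OPTIONS --safe #-}

-- Let Rᵢ and Cⱼ be the sums of T⁻ over row i and column j.  A cell can be added
-- in row i + 1 exactly when one can be removed from row i, so Rᵢ ≡ q Rᵢ₊₁ and
-- likewise Cⱼ ≡ q Cⱼ₊₁.  A cell can be added in row 1 exactly when (1 , b) is
-- missing, that is, when column b has nothing to remove; hence 1 - C_b ≡ q R₁ ≡ q^a R_a.
-- Since the Rᵢ and the Cⱼ have the same total, [a] R_a ≡ [b] C_b ≡ [b] (1 - q^a R_a),
-- and [a] + q^a [b] = [a + b] gives R_a ≡ [b] / [a + b]; columns are symmetric.

module Submission where

open import Defs hiding (_^_; sum-syntax; fromPoly; _/_; rationalFunctionRing)
open import Data.Fin.Base using (Fin; toℕ)
open import Data.Nat.Base using (ℕ; NonZero; suc; _+_; _∸_)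
open import Data.Product.Base using (_×_; _,_)
open import Function.Base using (const)

open import Algebra.Apartness.Bundles using (HeytingField)
open import Algebra.Bundles using (CommutativeRing)
open import Data.Bool.Base as Bool using (Bool; true; false; if_then_else_; _∧_; not; f≤t; b≤b)
open import Data.Bool.Properties using (∧-comm)
open import Data.Fin.Base as Fin using (zero; suc; inject₁; fromℕ)
open import Data.Fin.Induction using (>-weakInduction)
open import Data.List.Base using ([]; _∷_; replicate)
open import Data.Nat.Base as ℕ using (zero; s≤s)
open import Data.Product.Base using (∃; ∃₂; proj₁; proj₂)
open import Data.Sum.Base using (_⊎_; inj₁; inj₂)
open import Function.Base using (_∘_; flip)
open import Function.Bundles using (_⇔_; mk⇔)
open import Level using (Level; _⊔_)
open import Relation.Binary.Bundles using (Setoid)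
open import Relation.Binary.PropositionalEquality as ≡ using (_≡_)
open import Relation.Nullary using (¬_; Dec; does; yes; no; contradiction; decidable-stable; ¬?; _×-dec_; _⊎-dec_)
open import Relation.Nullary.Decidable using (does-⇔; dec-true; dec-false)
open import Relation.Unary using (∁)
import Algebra.Properties.Ring as RingProps
import Algebra.Properties.Semiring.Exp as Exp
import Algebra.Properties.Semiring.Sum as Sums
import Algebra.Solver.Ring.NaturalCoefficients.Default as NatSolver
import Data.Fin.Properties as Fin
import Data.Nat.Properties as ℕ
import Relation.Binary.Reasoning.Setoid as SetoidReasoning

-- Geometric sums in a commutative ring.

module GeometricSums {c ℓ : Level} (R : CommutativeRing c ℓ) (t : CommutativeRing.Carrier R) where
  open CommutativeRing R hiding (zero) renaming (_+_ to _⊕_; _*_ to _⊛_)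
  open Exp semiring using (_^_)
  open Sums semiring using (sum-syntax)
  open SetoidReasoning setoid
  open NatSolver commutativeSemiring using (solve; _:=_; _:+_; _:*_)

  -- Horner's form of 1 + t + ... + t^(n-1). At t = q it is [n]_q, and the recursion matches
  -- prepending a 1 to a list of coefficients.
  geometric : ℕ → Carrier
  geometric zero    = 0#
  geometric (suc n) = 1# ⊕ t ⊛ geometric n

  geometric-+ : ∀ m n → geometric (m + n) ≈ geometric m ⊕ t ^ m ⊛ geometric n
  geometric-+ zero    n = sym (trans (+-identityˡ _) (*-identityˡ _))
  geometric-+ (suc m) n = begin
    1# ⊕ t ⊛ geometric (m + n)
      ≈⟨ +-congˡ (*-congˡ (geometric-+ m n)) ⟩
    1# ⊕ t ⊛ (geometric m ⊕ t ^ m ⊛ geometric n)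
      ≈⟨ solve 5 (λ o t g p h → o :+ t :* (g :+ p :* h) := (o :+ t :* g) :+ (t :* p) :* h) refl
           1# t (geometric m) (t ^ m) (geometric n) ⟩
    geometric (suc m) ⊕ t ^ suc m ⊛ geometric n ∎

  -- The definition grows at the constant term, whereas the decreasing exponents in `∑-powers` shed
  -- the top power first, so the recursion is needed from the other end.
  geometric-suc : ∀ n → t ^ n ⊕ geometric n ≈ geometric (suc n)
  geometric-suc zero    = +-congˡ (sym (zeroʳ t))
  geometric-suc (suc n) = begin
    t ⊛ t ^ n ⊕ (1# ⊕ t ⊛ geometric n)
      ≈⟨ solve 4 (λ o t p g → t :* p :+ (o :+ t :* g) := o :+ t :* (p :+ g)) refl
           1# t (t ^ n) (geometric n) ⟩
    1# ⊕ t ⊛ (t ^ n ⊕ geometric n)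
      ≈⟨ +-congˡ (*-congˡ (geometric-suc n)) ⟩
    geometric (suc (suc n)) ∎

  ∑-powers : ∀ n → ∑[ i < n ] (t ^ (n ∸ suc (toℕ i))) ≈ geometric n
  ∑-powers zero    = refl
  ∑-powers (suc n) = trans (+-congˡ (∑-powers n)) (geometric-suc n)

  geometric-unique : (f : ℕ → Carrier) → f 0 ≈ 0# → (∀ n → f (suc n) ≈ 1# ⊕ t ⊛ f n) →
                     ∀ n → f n ≈ geometric n
  geometric-unique f base step zero    = base
  geometric-unique f base step (suc n) =
    trans (step n) (+-congˡ (*-congˡ (geometric-unique f base step n)))

-- Order ideals as Boolean arrays.

-- m s t tells whether (s , t), counted from 1, lies in an order ideal of
-- [a] × [b], with row 0 and column 0 adjoined to the ideal; removable m s t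
-- and addable m s t concern the cell (s + 1 , t + 1).
removable addable : (ℕ → ℕ → Bool) → ℕ → ℕ → Bool
removable m s t = m (suc s) (suc t) ∧ (not (m (suc (suc s)) (suc t)) ∧ not (m (suc s) (suc (suc t))))
addable   m s t = not (m (suc s) (suc t)) ∧ (m s (suc t) ∧ m (suc s) t)

-- Row 0 and column 0 are full at every index, so row `a + 1` and column `b + 1` can be empty only
-- away from them: hence the `suc s` in `right` and the `suc t` in `below`.
record IsIdealArray (a b : ℕ) (m : ℕ → ℕ → Bool) : Set where
  field
    decreasingʳ : ∀ s t → m s (suc t) Bool.≤ m s t
    decreasingˡ : ∀ s t → m (suc s) t Bool.≤ m s t
    row₀        : ∀ t → m 0 t ≡ true
    column₀     : ∀ s → m s 0 ≡ true
    right       : ∀ s → m (suc s) (suc b) ≡ false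
    below       : ∀ t → m (suc a) (suc t) ≡ false

flip-isIdealArray : ∀ {a b m} → IsIdealArray a b m → IsIdealArray b a (flip m)
flip-isIdealArray ideal = record
  { decreasingʳ = flip decreasingˡ ; decreasingˡ = flip decreasingʳ
  ; row₀ = column₀ ; column₀ = row₀ ; right = below ; below = right }
  where open IsIdealArray ideal

removable-flip : ∀ m s t → removable m s t ≡ removable (flip m) t s
removable-flip m s t = ≡.cong (m (suc s) (suc t) ∧_) (∧-comm (not (m (suc (suc s)) (suc t))) _)

addable-flip : ∀ m s t → addable m s t ≡ addable (flip m) t s
addable-flip m s t = ≡.cong (not (m (suc s) (suc t)) ∧_) (∧-comm (m s (suc t)) _)

-- Telescoping along the rows and columns of an array.

module BooleanArrays {c ℓ : Level} (R : CommutativeRing c ℓ) where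
  open CommutativeRing R hiding (zero) renaming (_+_ to _⊕_; _*_ to _⊛_)
  open Sums semiring using (sum-syntax; sum-replicate-zero)
  open SetoidReasoning setoid
  open NatSolver commutativeSemiring using (solve; _:=_; _:+_)

  ⟦_⟧ : Bool → Carrier
  ⟦ x ⟧ = if x then 1# else 0#

  -- The additive form of `f k - g k = h k - h (suc k)`; without subtraction, each instance of the
  -- hypothesis becomes a finite check on Booleans.
  telescope : ∀ n (f g h : ℕ → Carrier) → (∀ k → f k ⊕ h (suc k) ≈ g k ⊕ h k) →
              ∑[ i < n ] f (toℕ i) ⊕ h n ≈ ∑[ i < n ] g (toℕ i) ⊕ h 0
  telescope zero    f g h step = refl
  telescope (suc n) f g h step = begin
    (f 0 ⊕ ∑[ i < n ] f (suc (toℕ i))) ⊕ h (suc n)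
      ≈⟨ +-assoc _ _ _ ⟩
    f 0 ⊕ (∑[ i < n ] f (suc (toℕ i)) ⊕ h (suc n))
      ≈⟨ +-congˡ (telescope n (f ∘ suc) (g ∘ suc) (h ∘ suc) (step ∘ suc)) ⟩
    f 0 ⊕ (∑[ i < n ] g (suc (toℕ i)) ⊕ h 1)
      ≈⟨ solve 3 (λ x y z → x :+ (y :+ z) := (x :+ z) :+ y) refl (f 0) _ (h 1) ⟩
    (f 0 ⊕ h 1) ⊕ ∑[ i < n ] g (suc (toℕ i))
      ≈⟨ +-congʳ (step 0) ⟩
    (g 0 ⊕ h 0) ⊕ ∑[ i < n ] g (suc (toℕ i))
      ≈⟨ solve 3 (λ x z y → (x :+ z) :+ y := (x :+ y) :+ z) refl (g 0) (h 0) _ ⟩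
    (g 0 ⊕ ∑[ i < n ] g (suc (toℕ i))) ⊕ h 0 ∎

  telescope₀ : ∀ n (f h : ℕ → Carrier) → (∀ k → f k ⊕ h (suc k) ≈ h k) →
               ∑[ i < n ] f (toℕ i) ⊕ h n ≈ h 0
  telescope₀ n f h step = begin
    ∑[ i < n ] f (toℕ i) ⊕ h n    ≈⟨ telescope n f (λ _ → 0#) h (λ k → trans (step k) (sym (+-identityˡ _))) ⟩
    ∑[ i < n ] 0# ⊕ h 0           ≈⟨ +-congʳ (sum-replicate-zero n) ⟩
    0# ⊕ h 0                      ≈⟨ +-identityˡ _ ⟩
    h 0                           ∎

  private
    -- In each of these four identities the event on the right is cut in two by one of the Booleans,
    -- and monotonicity shortens one half. Here the cut is by `z`, and `z ≤ x` shortens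
    -- `x ∧ not y ∧ z` to `z ∧ not y`.
    split-∧-not : ∀ {x z} y → z Bool.≤ x → ⟦ x ∧ (not y ∧ not z) ⟧ ⊕ ⟦ z ∧ not y ⟧ ≈ ⟦ x ∧ not y ⟧
    split-∧-not             true  f≤t = +-identityˡ 0#
    split-∧-not             false f≤t = +-identityʳ 1#
    split-∧-not {x = true}  true  b≤b = +-identityˡ 0#
    split-∧-not {x = true}  false b≤b = +-identityˡ 1#
    split-∧-not {x = false} _     b≤b = +-identityˡ 0#

    split-∧-not′ : ∀ x {y w} → y Bool.≤ w → ⟦ not y ∧ (x ∧ w) ⟧ ⊕ ⟦ x ∧ not w ⟧ ≈ ⟦ x ∧ not y ⟧
    split-∧-not′ true              f≤t = +-identityʳ 1#
    split-∧-not′ false             f≤t = +-identityˡ 0#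
    split-∧-not′ true  {y = true}  b≤b = +-identityˡ 0#
    split-∧-not′ true  {y = false} b≤b = +-identityˡ 1#
    split-∧-not′ false {y = true}  b≤b = +-identityˡ 0#
    split-∧-not′ false {y = false} b≤b = +-identityˡ 0#

    split-not : ∀ {y w} → y Bool.≤ w → ⟦ not y ∧ w ⟧ ⊕ ⟦ y ⟧ ≈ ⟦ w ⟧
    split-not             f≤t = +-identityʳ 1#
    split-not {y = true}  b≤b = +-identityˡ 1#
    split-not {y = false} b≤b = +-identityˡ 0#

    split-∧ : ∀ {x z} → z Bool.≤ x → ⟦ x ∧ (not z ∧ true) ⟧ ⊕ ⟦ z ⟧ ≈ ⟦ x ⟧
    split-∧             f≤t = +-identityʳ 1#
    split-∧ {x = true}  b≤b = +-identityˡ 1#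
    split-∧ {x = false} b≤b = +-identityˡ 0#

  -- The columns that meet row `s + 1` but not row `s + 2` form an interval. If it is nonempty, its
  -- last column holds the removable cell of the upper row and its first column the addable cell of
  -- the lower row.
  ∑-addable≈∑-removable : ∀ {a b m} → IsIdealArray a b m → ∀ s →
    ∑[ j < b ] ⟦ addable m (suc s) (toℕ j) ⟧ ≈ ∑[ j < b ] ⟦ removable m s (toℕ j) ⟧
  ∑-addable≈∑-removable {b = b} {m} ideal s = begin
    ∑⁺           ≈⟨ +-identityʳ ∑⁺ ⟨
    ∑⁺ ⊕ 0#      ≡⟨ ≡.cong (∑⁺ ⊕_) h0≡0 ⟨
    ∑⁺ ⊕ h 0
      ≈⟨ telescope b (λ t → ⟦ removable m s t ⟧) (λ t → ⟦ addable m (suc s) t ⟧) h (λ t →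
           trans (split-∧-not (y (suc t)) (decreasingʳ _ (suc t)))
                 (sym (split-∧-not′ (x (suc t)) (decreasingʳ _ t)))) ⟨
    ∑⁻ ⊕ h b     ≡⟨ ≡.cong (∑⁻ ⊕_) hb≡0 ⟩
    ∑⁻ ⊕ 0#      ≈⟨ +-identityʳ ∑⁻ ⟩
    ∑⁻           ∎
    where
    open IsIdealArray ideal
    ∑⁺ ∑⁻ : Carrier
    ∑⁺ = ∑[ j < b ] ⟦ addable m (suc s) (toℕ j) ⟧
    ∑⁻ = ∑[ j < b ] ⟦ removable m s (toℕ j) ⟧
    x y : ℕ → Bool
    x = m (suc s)
    y = m (suc (suc s))
    h : ℕ → Carrier
    -- `h t` says that columns `t` and `t + 1` both lie in the interval. A removable cell plus
    -- `h (t + 1)`, and an addable cell plus `h t`, both give membership of column `t + 1`. At the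
    -- ends `h` vanishes: column 0 meets the lower row and column `b + 1` misses the upper one.
    h t = ⟦ x (suc t) ∧ not (y t) ⟧
    h0≡0 : h 0 ≡ 0#
    h0≡0 rewrite column₀ (suc (suc s)) with x 1
    ... | true  = ≡.refl
    ... | false = ≡.refl
    hb≡0 : h b ≡ 0#
    hb≡0 rewrite right s = ≡.refl

  -- The first sum is 1 unless the ideal contains (1 , b + 1), and the second sum
  -- is 1 precisely when it does.
  ∑-addable+∑-removable≈1 : ∀ {a b m} → IsIdealArray a (suc b) m →
    ∑[ j < suc b ] ⟦ addable m 0 (toℕ j) ⟧ ⊕ ∑[ i < a ] ⟦ removable m (toℕ i) b ⟧ ≈ 1#
  ∑-addable+∑-removable≈1 {a} {b} {m} ideal = begin
    ∑⁺ ⊕ ∑⁻                         ≈⟨ +-congˡ (+-identityʳ ∑⁻) ⟨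
    ∑⁺ ⊕ (∑⁻ ⊕ 0#)                  ≡⟨ ≡.cong (λ x → ∑⁺ ⊕ (∑⁻ ⊕ ⟦ x ⟧)) (below b) ⟨
    ∑⁺ ⊕ (∑⁻ ⊕ ⟦ m (suc a) (suc b) ⟧)
      ≈⟨ +-congˡ (telescope₀ a (λ s → ⟦ removable m s b ⟧) (λ s → ⟦ m (suc s) (suc b) ⟧) column) ⟩
    ∑⁺ ⊕ ⟦ m 1 (suc b) ⟧
      ≈⟨ telescope₀ (suc b) (λ t → ⟦ addable m 0 t ⟧) (λ t → ⟦ m 1 t ⟧) row ⟩
    ⟦ m 1 0 ⟧                       ≡⟨ ≡.cong ⟦_⟧ (column₀ 1) ⟩
    1#                              ∎
    where
    open IsIdealArray ideal
    ∑⁺ ∑⁻ : Carrier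
    ∑⁺ = ∑[ j < suc b ] ⟦ addable m 0 (toℕ j) ⟧
    ∑⁻ = ∑[ i < a ] ⟦ removable m (toℕ i) b ⟧
    column : ∀ s → ⟦ removable m s b ⟧ ⊕ ⟦ m (suc (suc s)) (suc b) ⟧ ≈ ⟦ m (suc s) (suc b) ⟧
    -- Cells of the last column have no right neighbour, so removability there depends only on the
    -- cell below and telescopes down the column.
    column s rewrite right s = split-∧ (decreasingˡ (suc s) (suc b))
    row : ∀ t → ⟦ addable m 0 t ⟧ ⊕ ⟦ m 1 (suc t) ⟧ ≈ ⟦ m 1 t ⟧
    row t rewrite row₀ (suc t) = split-not (decreasingʳ 1 t)

-- Congruence modulo the span of a family of functions.

module Congruence {c ℓ j : Level} (R : CommutativeRing c ℓ) {J : Set j} {a b : ℕ}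
                  (τ : Fin a × Fin b → J → CommutativeRing.Carrier R) where
  open CommutativeRing R hiding (zero) renaming (_+_ to _⊕_; _*_ to _⊛_; _-_ to _⊖_)
  open Sums semiring using (sum-syntax; sum-cong-≋; ∑-distrib-+; sum-replicate-zero; *-distribˡ-sum)
  open RingProps ring using (-1*x≈-x; x[y-z]≈xy-xz; -‿+-comm; ⁻¹-anti-homo‿-)
  open NatSolver commutativeSemiring using (solve; _:=_; _:+_)
  open SetoidReasoning setoid

  combination : (Fin a × Fin b → Carrier) → J → Carrier
  combination k I = ∑[ i < a ] ∑[ j < b ] (k (i , j) ⊛ τ (i , j) I)

  infix 4 _≋_
  -- The span is that of the functions `τ p` over `R`; `_≡q_` is the case of `ℝ⟨q⟩` and `Tq`.
  record _≋_ (f g : J → Carrier) : Set (c ⊔ ℓ ⊔ j) where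
    constructor mk≋
    field
      coefficients : Fin a × Fin b → Carrier
      difference   : ∀ I → f I ⊖ g I ≈ combination coefficients I

  private
    ∑∑-cong : ∀ {f g : Fin a → Fin b → Carrier} → (∀ i j → f i j ≈ g i j) →
              ∑[ i < a ] ∑[ j < b ] f i j ≈ ∑[ i < a ] ∑[ j < b ] g i j
    ∑∑-cong f≈g = sum-cong-≋ λ i → sum-cong-≋ (f≈g i)

    combination-0 : ∀ I → combination (λ _ → 0#) I ≈ 0#
    combination-0 I = begin
      ∑[ i < a ] ∑[ j < b ] (0# ⊛ τ (i , j) I)    ≈⟨ ∑∑-cong (λ i j → zeroˡ _) ⟩
      ∑[ i < a ] ∑[ j < b ] 0#                    ≈⟨ sum-cong-≋ {a} (λ i → sum-replicate-zero b) ⟩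
      ∑[ i < a ] 0#                               ≈⟨ sum-replicate-zero a ⟩
      0#                                          ∎

    combination-+ : ∀ k l I → combination k I ⊕ combination l I ≈ combination (λ p → k p ⊕ l p) I
    combination-+ k l I = begin
      combination k I ⊕ combination l I
        ≈⟨ ∑-distrib-+ {a} _ _ ⟨
      ∑[ i < a ] (∑[ j < b ] (k (i , j) ⊛ τ (i , j) I) ⊕ ∑[ j < b ] (l (i , j) ⊛ τ (i , j) I))
        ≈⟨ sum-cong-≋ {a} (λ i → ∑-distrib-+ {b} _ _) ⟨
      ∑[ i < a ] ∑[ j < b ] (k (i , j) ⊛ τ (i , j) I ⊕ l (i , j) ⊛ τ (i , j) I)
        ≈⟨ ∑∑-cong (λ i j → distribʳ _ _ _) ⟨
      combination (λ p → k p ⊕ l p) I ∎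

    combination-* : ∀ x k I → x ⊛ combination k I ≈ combination (λ p → x ⊛ k p) I
    combination-* x k I = begin
      x ⊛ combination k I
        ≈⟨ *-distribˡ-sum {a} x _ ⟩
      ∑[ i < a ] (x ⊛ ∑[ j < b ] (k (i , j) ⊛ τ (i , j) I))
        ≈⟨ sum-cong-≋ {a} (λ i → *-distribˡ-sum {b} x _) ⟩
      ∑[ i < a ] ∑[ j < b ] (x ⊛ (k (i , j) ⊛ τ (i , j) I))
        ≈⟨ ∑∑-cong (λ i j → *-assoc _ _ _) ⟨
      combination (λ p → x ⊛ k p) I ∎

    δ : ∀ {n} → Fin n → Fin n → Carrier
    δ zero    zero    = 1#
    δ zero    (suc _) = 0#
    δ (suc _) zero    = 0#
    δ (suc i) (suc j) = δ i j

    ∑-δ : ∀ {n} (i : Fin n) (f : Fin n → Carrier) → ∑[ k < n ] (δ i k ⊛ f k) ≈ f i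
    ∑-δ {suc n} zero f = begin
      1# ⊛ f zero ⊕ ∑[ k < n ] (0# ⊛ f (suc k))
        ≈⟨ +-cong (*-identityˡ _) (trans (sum-cong-≋ {n} (λ k → zeroˡ _)) (sum-replicate-zero n)) ⟩
      f zero ⊕ 0#
        ≈⟨ +-identityʳ _ ⟩
      f zero ∎
    ∑-δ {suc n} (suc i) f = begin
      0# ⊛ f zero ⊕ ∑[ k < n ] (δ i k ⊛ f (suc k))    ≈⟨ +-cong (zeroˡ _) (∑-δ i (f ∘ suc)) ⟩
      0# ⊕ f (suc i)                                  ≈⟨ +-identityˡ _ ⟩
      f (suc i)                                       ∎

    combination-δ : ∀ i j I → combination (λ (i′ , j′) → δ i i′ ⊛ δ j j′) I ≈ τ (i , j) I
    combination-δ i j I = begin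
      ∑[ i′ < a ] ∑[ j′ < b ] ((δ i i′ ⊛ δ j j′) ⊛ τ (i′ , j′) I)
        ≈⟨ ∑∑-cong (λ i′ j′ → *-assoc _ _ _) ⟩
      ∑[ i′ < a ] ∑[ j′ < b ] (δ i i′ ⊛ (δ j j′ ⊛ τ (i′ , j′) I))
        ≈⟨ sum-cong-≋ {a} (λ i′ → *-distribˡ-sum {b} (δ i i′) _) ⟨
      ∑[ i′ < a ] (δ i i′ ⊛ ∑[ j′ < b ] (δ j j′ ⊛ τ (i′ , j′) I))
        ≈⟨ ∑-δ i _ ⟩
      ∑[ j′ < b ] (δ j j′ ⊛ τ (i , j′) I)
        ≈⟨ ∑-δ j _ ⟩
      τ (i , j) I ∎

  ≋-generator : ∀ p {f g} → (∀ I → f I ⊖ g I ≈ τ p I) → f ≋ g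
  -- The coefficients left open are the Kronecker delta at `(i , j)`, determined by `combination-δ`.
  ≋-generator (i , j) eq = mk≋ _ λ I → trans (eq I) (sym (combination-δ i j I))

  ≈⇒≋ : ∀ {f g} → (∀ I → f I ≈ g I) → f ≋ g
  ≈⇒≋ {f} {g} f≈g = mk≋ (λ _ → 0#) λ I → begin
    f I ⊖ g I                    ≈⟨ +-congʳ (f≈g I) ⟩
    g I ⊖ g I                    ≈⟨ -‿inverseʳ _ ⟩
    0#                           ≈⟨ combination-0 I ⟨
    combination (λ _ → 0#) I     ∎

  ≋-refl : ∀ {f} → f ≋ f
  ≋-refl = ≈⇒≋ λ _ → refl

  ≋-sym : ∀ {f g} → f ≋ g → g ≋ f
  ≋-sym {f} {g} (mk≋ k eq) = mk≋ (λ p → - 1# ⊛ k p) λ I → begin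
    g I ⊖ f I                            ≈⟨ ⁻¹-anti-homo‿- (f I) (g I) ⟨
    - (f I ⊖ g I)                        ≈⟨ -1*x≈-x _ ⟨
    - 1# ⊛ (f I ⊖ g I)                   ≈⟨ *-congˡ (eq I) ⟩
    - 1# ⊛ combination k I               ≈⟨ combination-* (- 1#) k I ⟩
    combination (λ p → - 1# ⊛ k p) I     ∎

  ≋-trans : ∀ {f g h} → f ≋ g → g ≋ h → f ≋ h
  ≋-trans {f} {g} {h} (mk≋ k eq) (mk≋ l eq′) = mk≋ (λ p → k p ⊕ l p) λ I → begin
    f I ⊖ h I                            ≈⟨ +-congˡ (+-identityˡ (- h I)) ⟨
    f I ⊕ (0# ⊖ h I)                     ≈⟨ +-congˡ (+-congʳ (-‿inverseˡ (g I))) ⟨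
    f I ⊕ ((- g I ⊕ g I) ⊖ h I)
      ≈⟨ solve 4 (λ f g′ g h′ → f :+ ((g′ :+ g) :+ h′) := (f :+ g′) :+ (g :+ h′)) refl
           (f I) (- g I) (g I) (- h I) ⟩
    (f I ⊖ g I) ⊕ (g I ⊖ h I)            ≈⟨ +-cong (eq I) (eq′ I) ⟩
    combination k I ⊕ combination l I    ≈⟨ combination-+ k l I ⟩
    combination (λ p → k p ⊕ l p) I      ∎

  ≋-setoid : Setoid (c ⊔ j) (c ⊔ ℓ ⊔ j)
  ≋-setoid = record
    { Carrier = J → Carrier ; _≈_ = _≋_
    ; isEquivalence = record { refl = ≋-refl ; sym = ≋-sym ; trans = ≋-trans } }

  ≋-+-cong : ∀ {f f′ g g′} → f ≋ f′ → g ≋ g′ → (λ I → f I ⊕ g I) ≋ (λ I → f′ I ⊕ g′ I)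
  ≋-+-cong {f} {f′} {g} {g′} (mk≋ k eq) (mk≋ l eq′) = mk≋ (λ p → k p ⊕ l p) λ I → begin
    (f I ⊕ g I) ⊖ (f′ I ⊕ g′ I)          ≈⟨ +-congˡ (-‿+-comm (f′ I) (g′ I)) ⟨
    (f I ⊕ g I) ⊕ (- f′ I ⊖ g′ I)
      ≈⟨ solve 4 (λ f g f′ g′ → (f :+ g) :+ (f′ :+ g′) := (f :+ f′) :+ (g :+ g′)) refl
           (f I) (g I) (- f′ I) (- g′ I) ⟩
    (f I ⊖ f′ I) ⊕ (g I ⊖ g′ I)          ≈⟨ +-cong (eq I) (eq′ I) ⟩
    combination k I ⊕ combination l I    ≈⟨ combination-+ k l I ⟩
    combination (λ p → k p ⊕ l p) I      ∎

  ≋-*-congˡ : ∀ x {f g} → f ≋ g → (λ I → x ⊛ f I) ≋ (λ I → x ⊛ g I)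
  ≋-*-congˡ x {f} {g} (mk≋ k eq) = mk≋ (λ p → x ⊛ k p) λ I → begin
    x ⊛ f I ⊖ x ⊛ g I                ≈⟨ x[y-z]≈xy-xz x _ _ ⟨
    x ⊛ (f I ⊖ g I)                  ≈⟨ *-congˡ (eq I) ⟩
    x ⊛ combination k I              ≈⟨ combination-* x k I ⟩
    combination (λ p → x ⊛ k p) I    ∎

  ≋-∑-cong : ∀ {n} {f g : Fin n → J → Carrier} → (∀ i → f i ≋ g i) →
             (λ I → ∑[ i < n ] f i I) ≋ (λ I → ∑[ i < n ] g i I)
  ≋-∑-cong {zero}  f≋g = ≋-refl
  ≋-∑-cong {suc n} f≋g = ≋-+-cong (f≋g zero) (≋-∑-cong (f≋g ∘ suc))

-- Geometric progressions modulo the span.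

module LinearAlgebra {c ℓ j : Level} (R : CommutativeRing c ℓ) (t : CommutativeRing.Carrier R)
                     {J : Set j} {a b : ℕ} (τ : Fin a × Fin b → J → CommutativeRing.Carrier R) where
  open CommutativeRing R hiding (zero) renaming (_+_ to _⊕_; _*_ to _⊛_)
  open Exp semiring using (_^_; ^-congʳ)
  open Sums semiring using (sum-syntax; *-distribʳ-sum)
  open NatSolver commutativeSemiring using (solve; _:=_; _:+_; _:*_)
  open GeometricSums R t
  open Congruence R τ
  open SetoidReasoning ≋-setoid

  -- Each term is `t` times its successor, so all terms are multiples of the last one and `t` never
  -- has to be inverted.
  _-Progression : ∀ {n} → (Fin (suc n) → J → Carrier) → Set (c ⊔ ℓ ⊔ j)
  f -Progression = ∀ i → f (inject₁ i) ≋ λ I → t ⊛ f (suc i) I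

  -- Downward induction from the last index, gaining one factor `t` per step.
  progression-term : ∀ {n} (f : Fin (suc n) → J → Carrier) → f -Progression →
                     ∀ i → f i ≋ λ I → t ^ (n ∸ toℕ i) ⊛ f (fromℕ n) I
  progression-term {n} f step = >-weakInduction _ last next
    where
    last : f (fromℕ n) ≋ λ I → t ^ (n ∸ toℕ (fromℕ n)) ⊛ f (fromℕ n) I
    last = ≈⇒≋ λ I → trans (sym (*-identityˡ _))
      (*-congʳ (^-congʳ t (≡.sym (≡.trans (≡.cong (n ∸_) (Fin.toℕ-fromℕ n)) (ℕ.n∸n≡0 n)))))
    -- The truncated subtraction is exact here because `toℕ i < n`.
    exponent : (i : Fin n) → suc (n ∸ suc (toℕ i)) ≡ n ∸ toℕ (inject₁ i)
    exponent i = ≡.trans (≡.sym (ℕ.+-∸-assoc 1 (Fin.toℕ<n i))) (≡.cong (n ∸_) (≡.sym (Fin.toℕ-inject₁ i)))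
    next : ∀ i → (f (suc i) ≋ λ I → t ^ (n ∸ suc (toℕ i)) ⊛ f (fromℕ n) I) →
           f (inject₁ i) ≋ λ I → t ^ (n ∸ toℕ (inject₁ i)) ⊛ f (fromℕ n) I
    next i ih = begin
      f (inject₁ i)                                              ≈⟨ step i ⟩
      (λ I → t ⊛ f (suc i) I)                                    ≈⟨ ≋-*-congˡ t ih ⟩
      (λ I → t ⊛ (t ^ (n ∸ suc (toℕ i)) ⊛ f (fromℕ n) I))        ≈⟨ ≈⇒≋ (λ I → sym (*-assoc _ _ _)) ⟩
      (λ I → t ^ suc (n ∸ suc (toℕ i)) ⊛ f (fromℕ n) I)          ≈⟨ ≈⇒≋ (λ I → *-congʳ (^-congʳ t (exponent i))) ⟩
      (λ I → t ^ (n ∸ toℕ (inject₁ i)) ⊛ f (fromℕ n) I)          ∎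

  progression-sum : ∀ {n} (f : Fin (suc n) → J → Carrier) → f -Progression →
                    (λ I → ∑[ i < suc n ] f i I) ≋ λ I → geometric (suc n) ⊛ f (fromℕ n) I
  progression-sum {n} f step = begin
    (λ I → ∑[ i < suc n ] f i I)
      ≈⟨ ≋-∑-cong (progression-term f step) ⟩
    (λ I → ∑[ i < suc n ] (t ^ (n ∸ toℕ i) ⊛ f (fromℕ n) I))
      ≈⟨ ≈⇒≋ (λ I → *-distribʳ-sum {suc n} (f (fromℕ n) I) (λ i → t ^ (n ∸ toℕ i))) ⟨
    (λ I → ∑[ i < suc n ] (t ^ (n ∸ toℕ i)) ⊛ f (fromℕ n) I)
      ≈⟨ ≈⇒≋ (λ I → *-congʳ (∑-powers (suc n))) ⟩
    (λ I → geometric (suc n) ⊛ f (fromℕ n) I) ∎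

  -- `f` and `g` are the row and column sums in either order, so both halves of the theorem are
  -- instances; `u` is the sum of `T⁺` over the first line of the kind summed by `f`. The last terms
  -- of `f` and `g` solve two linear congruences with determinant `geometric (suc m + suc n)`, whose
  -- inverse is `w`.
  coupled-progressions : ∀ {m n w} {f : Fin (suc m) → J → Carrier} {g : Fin (suc n) → J → Carrier} {u} →
    f -Progression → g -Progression →
    (∀ I → ∑[ i < suc m ] f i I ≈ ∑[ i < suc n ] g i I) →
    (u ≋ λ I → t ⊛ f zero I) → (∀ I → u I ⊕ g (fromℕ n) I ≈ 1#) →
    geometric (suc m + suc n) ⊛ w ≈ 1# →
    ∀ i → g i ≋ const (t ^ (n ∸ toℕ i) ⊛ (geometric (suc m) ⊛ w))
  coupled-progressions {m} {n} {w} {f} {g} {u} f-step g-step ∑f≈∑g u≋tf u+g≈1 inverse i = begin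
    g i                                           ≈⟨ progression-term g g-step i ⟩
    (λ I → t ^ (n ∸ toℕ i) ⊛ y I)                 ≈⟨ ≋-*-congˡ _ y≋ ⟩
    const (t ^ (n ∸ toℕ i) ⊛ (A ⊛ w))             ∎
    where
    A B : Carrier
    A = geometric (suc m)
    B = geometric (suc n)
    x y : J → Carrier
    x = f (fromℕ m)
    y = g (fromℕ n)
    Ax≋By : (λ I → A ⊛ x I) ≋ λ I → B ⊛ y I
    Ax≋By = begin
      (λ I → A ⊛ x I)                   ≈⟨ progression-sum f f-step ⟨
      (λ I → ∑[ i < suc m ] f i I)      ≈⟨ ≈⇒≋ ∑f≈∑g ⟩
      (λ I → ∑[ i < suc n ] g i I)      ≈⟨ progression-sum g g-step ⟩
      (λ I → B ⊛ y I)                   ∎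
    u≋ : u ≋ λ I → t ^ suc m ⊛ x I
    u≋ = begin
      u                                 ≈⟨ u≋tf ⟩
      (λ I → t ⊛ f zero I)              ≈⟨ ≋-*-congˡ t (progression-term f f-step zero) ⟩
      (λ I → t ⊛ (t ^ m ⊛ x I))         ≈⟨ ≈⇒≋ (λ I → sym (*-assoc _ _ _)) ⟩
      (λ I → t ^ suc m ⊛ x I)           ∎
    A≋ : const A ≋ λ I → geometric (suc m + suc n) ⊛ y I
    A≋ = begin
      -- Scaling 1 = u + y by `A` makes `x` occur only as `A ⊛ x`, which can be exchanged for
      -- `B ⊛ y`; neither `A` nor `B` needs an inverse.
      const A
        ≈⟨ ≈⇒≋ (λ I → trans (*-congˡ (u+g≈1 I)) (*-identityʳ A)) ⟨
      (λ I → A ⊛ (u I ⊕ y I))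
        ≈⟨ ≋-*-congˡ A (≋-+-cong u≋ ≋-refl) ⟩
      (λ I → A ⊛ (t ^ suc m ⊛ x I ⊕ y I))
        ≈⟨ ≈⇒≋ (λ I → solve 4 (λ A p x y → A :* (p :* x :+ y) := A :* y :+ p :* (A :* x)) refl
                        A (t ^ suc m) (x I) (y I)) ⟩
      (λ I → A ⊛ y I ⊕ t ^ suc m ⊛ (A ⊛ x I))
        ≈⟨ ≋-+-cong ≋-refl (≋-*-congˡ (t ^ suc m) Ax≋By) ⟩
      (λ I → A ⊛ y I ⊕ t ^ suc m ⊛ (B ⊛ y I))
        ≈⟨ ≈⇒≋ (λ I → solve 4 (λ A p B y → A :* y :+ p :* (B :* y) := (A :+ p :* B) :* y) refl
                        A (t ^ suc m) B (y I)) ⟩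
      (λ I → (A ⊕ t ^ suc m ⊛ B) ⊛ y I)
        ≈⟨ ≈⇒≋ (λ I → *-congʳ (geometric-+ (suc m) (suc n))) ⟨
      (λ I → geometric (suc m + suc n) ⊛ y I) ∎
    y≋ : y ≋ const (A ⊛ w)
    y≋ = begin
      y                                                   ≈⟨ ≈⇒≋ (λ I → trans (*-congʳ inverse) (*-identityˡ _)) ⟨
      (λ I → (geometric (suc m + suc n) ⊛ w) ⊛ y I)
        ≈⟨ ≈⇒≋ (λ I → solve 3 (λ G w y → (G :* w) :* y := w :* (G :* y)) refl
                        (geometric (suc m + suc n)) w (y I)) ⟩
      (λ I → w ⊛ (geometric (suc m + suc n) ⊛ y I))       ≈⟨ ≋-*-congˡ w A≋ ⟨
      const (w ⊛ A)                                       ≈⟨ ≈⇒≋ (λ I → *-comm w A) ⟩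
      const (A ⊛ w)                                       ∎

-- Row and column sums of toggleability statistics.

module ToggleSums {c ℓ : Level} (R : CommutativeRing c ℓ) where
  open CommutativeRing R hiding (zero) renaming (_+_ to _⊕_; _*_ to _⊛_; _-_ to _⊖_)
  open Exp semiring using (_^_)
  open Sums semiring using (sum; sum-syntax; sum-cong-≗; sum-cong-≋; ∑-comm; *-distribˡ-sum)
  open BooleanArrays R

  -- The operations of R are passed a second time: at R = ℝ⟨q⟩ the conclusions
  -- phrased with _−_, _·_, _↑_ and ∑′ are syntactically those of _≡q_, whereas
  -- comparing them with the fields of R makes Agda unfold the apartness proofs of
  -- the denominators.
  module Relations
    {ℓ′ : Level} (_−_ _·_ : Carrier → Carrier → Carrier) (_↑_ : Carrier → ℕ → Carrier)
    (∑′ : ∀ n → (Fin n → Carrier) → Carrier)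
    (⊖≈− : ∀ x y → x ⊖ y ≈ x − y) (⊛≈· : ∀ x y → x ⊛ y ≈ x · y)
    (^≈↑ : ∀ x n → x ^ n ≈ x ↑ n) (∑≈∑′ : ∀ n f → sum f ≈ ∑′ n f)
    (t : Carrier) {J : Set ℓ′} {a b : ℕ}
    (m : J → ℕ → ℕ → Bool) (ideal : ∀ I → IsIdealArray (suc a) (suc b) (m I))
    (T⁺ T⁻ τ : Fin (suc a) × Fin (suc b) → J → Carrier)
    (T⁺≡ : ∀ i j I → T⁺ (i , j) I ≡ ⟦ addable (m I) (toℕ i) (toℕ j) ⟧)
    (T⁻≡ : ∀ i j I → T⁻ (i , j) I ≡ ⟦ removable (m I) (toℕ i) (toℕ j) ⟧)
    (τ≈ : ∀ p I → τ p I ≈ T⁺ p I − (t · T⁻ p I))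
    where
    open GeometricSums R t
    open Congruence R τ
    open LinearAlgebra R t τ

    row⁺ row⁻ : Fin (suc a) → J → Carrier
    row⁺ i I = ∑[ j < suc b ] T⁺ (i , j) I
    row⁻ i I = ∑[ j < suc b ] T⁻ (i , j) I

    column⁺ column⁻ : Fin (suc b) → J → Carrier
    column⁺ j I = ∑[ i < suc a ] T⁺ (i , j) I
    column⁻ j I = ∑[ i < suc a ] T⁻ (i , j) I

    minus-congˡ : ∀ {x y z} → y ≈ z → x − y ≈ x − z
    minus-congˡ y≈z = trans (sym (⊖≈− _ _)) (trans (+-congˡ (-‿cong y≈z)) (⊖≈− _ _))

    -- The difference of the two sides is the generator `τ p` itself.
    T⁺≋tT⁻ : ∀ p → T⁺ p ≋ λ I → t ⊛ T⁻ p I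
    T⁺≋tT⁻ p = ≋-generator p λ I →
      trans (⊖≈− _ _) (trans (minus-congˡ (⊛≈· t (T⁻ p I))) (sym (τ≈ p I)))

    row⁺≋t*row⁻ : ∀ i → row⁺ i ≋ λ I → t ⊛ row⁻ i I
    row⁺≋t*row⁻ i = ≋-trans (≋-∑-cong λ j → T⁺≋tT⁻ (i , j))
      (≈⇒≋ λ I → sym (*-distribˡ-sum t λ j → T⁻ (i , j) I))

    column⁺≋t*column⁻ : ∀ j → column⁺ j ≋ λ I → t ⊛ column⁻ j I
    column⁺≋t*column⁻ j = ≋-trans (≋-∑-cong λ i → T⁺≋tT⁻ (i , j))
      (≈⇒≋ λ I → sym (*-distribˡ-sum t λ i → T⁻ (i , j) I))

    -- Reading the array transposed lets the results on rows serve for columns.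
    T⁺≡flip : ∀ i j I → T⁺ (i , j) I ≡ ⟦ addable (flip (m I)) (toℕ j) (toℕ i) ⟧
    T⁺≡flip i j I = ≡.trans (T⁺≡ i j I) (≡.cong ⟦_⟧ (addable-flip (m I) (toℕ i) (toℕ j)))

    T⁻≡flip : ∀ i j I → T⁻ (i , j) I ≡ ⟦ removable (flip (m I)) (toℕ j) (toℕ i) ⟧
    T⁻≡flip i j I = ≡.trans (T⁻≡ i j I) (≡.cong ⟦_⟧ (removable-flip (m I) (toℕ i) (toℕ j)))

    -- This is an equality at every ideal: `inject₁ i` and `suc i` are consecutive rows. Only the
    -- exchange of `T⁺` for `T⁻` is a congruence.
    row⁻≈row⁺ : ∀ i I → row⁻ (inject₁ i) I ≈ row⁺ (suc i) I
    row⁻≈row⁺ i I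
      rewrite sum-cong-≗ (λ j → T⁻≡ (inject₁ i) j I) | sum-cong-≗ (λ j → T⁺≡ (suc i) j I) | Fin.toℕ-inject₁ i =
      sym (∑-addable≈∑-removable (ideal I) (toℕ i))

    column⁻≈column⁺ : ∀ j I → column⁻ (inject₁ j) I ≈ column⁺ (suc j) I
    column⁻≈column⁺ j I
      rewrite sum-cong-≗ (λ i → T⁻≡flip i (inject₁ j) I) | sum-cong-≗ (λ i → T⁺≡flip i (suc j) I) | Fin.toℕ-inject₁ j =
      sym (∑-addable≈∑-removable (flip-isIdealArray (ideal I)) (toℕ j))

    row⁻-progression : row⁻ -Progression
    row⁻-progression i = ≋-trans (≈⇒≋ (row⁻≈row⁺ i)) (row⁺≋t*row⁻ (suc i))

    column⁻-progression : column⁻ -Progression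
    column⁻-progression j = ≋-trans (≈⇒≋ (column⁻≈column⁺ j)) (column⁺≋t*column⁻ (suc j))

    row⁺+column⁻≈1 : ∀ I → row⁺ zero I ⊕ column⁻ (fromℕ b) I ≈ 1#
    row⁺+column⁻≈1 I
      rewrite sum-cong-≗ (λ j → T⁺≡ zero j I) | sum-cong-≗ (λ i → T⁻≡ i (fromℕ b) I) | Fin.toℕ-fromℕ b =
      ∑-addable+∑-removable≈1 (ideal I)

    column⁺+row⁻≈1 : ∀ I → column⁺ zero I ⊕ row⁻ (fromℕ a) I ≈ 1#
    column⁺+row⁻≈1 I
      rewrite sum-cong-≗ (λ i → T⁺≡flip i zero I) | sum-cong-≗ (λ j → T⁻≡flip (fromℕ a) j I) | Fin.toℕ-fromℕ a =
      ∑-addable+∑-removable≈1 (flip-isIdealArray (ideal I))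

    ∑-rows≈∑-columns : ∀ I → ∑[ i < suc a ] row⁻ i I ≈ ∑[ j < suc b ] column⁻ j I
    ∑-rows≈∑-columns I = ∑-comm λ i j → T⁻ (i , j) I

    -- `N n` stands for [n]_q as written in the theorem, `w` for the reciprocal of [.]_q at the sum
    -- of the side lengths, and `v` below for the quotient by it.
    module _ {N : ℕ → Carrier} (N≈ : ∀ n → N n ≈ geometric n)
             {w : Carrier} (inverse : N (suc a + suc b) · w ≈ 1#) where

      geometric-⊛ : ∀ {n v} → N n · w ≈ v → geometric n ⊛ w ≈ v
      geometric-⊛ {n} Nw≈v = trans (trans (*-congʳ (sym (N≈ n))) (⊛≈· (N n) w)) Nw≈v

      row⁻≋ : ∀ {v} → N (suc b) · w ≈ v → ∀ i → row⁻ i ≋ const (t ^ (a ∸ toℕ i) ⊛ v)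
      row⁻≋ Nw≈v i = ≋-trans
        (coupled-progressions {f = column⁻} {g = row⁻} column⁻-progression row⁻-progression
          (sym ∘ ∑-rows≈∑-columns) (column⁺≋t*column⁻ zero) column⁺+row⁻≈1
          -- With columns as `f` the side lengths are added in the opposite order.
          (≡.subst (λ n → geometric n ⊛ w ≈ 1#) (ℕ.+-comm (suc a) (suc b)) (geometric-⊛ inverse)) i)
        (≈⇒≋ λ _ → *-congˡ (geometric-⊛ Nw≈v))

      column⁻≋ : ∀ {v} → N (suc a) · w ≈ v → ∀ j → column⁻ j ≋ const (t ^ (b ∸ toℕ j) ⊛ v)
      column⁻≋ Nw≈v j = ≋-trans
        (coupled-progressions {f = row⁻} {g = column⁻} row⁻-progression column⁻-progression
          ∑-rows≈∑-columns (row⁺≋t*row⁻ zero) row⁺+column⁻≈1 (geometric-⊛ inverse) j)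
        (≈⇒≋ λ _ → *-congˡ (geometric-⊛ Nw≈v))

      -- The coefficients stay the same; only the operations change, from the fields of `R` to the
      -- copies that match `_≡q_`.
      ≋⇒∃ : ∀ {n k v} {f : J → Fin n → Carrier} →
            (λ I → ∑[ i < n ] f I i) ≋ const (t ^ k ⊛ v) →
            ∃ λ (κ : Fin (suc a) × Fin (suc b) → Carrier) → ∀ I →
              ∑′ n (f I) − ((t ↑ k) · v) ≈ ∑′ (suc a) (λ i → ∑′ (suc b) (λ j → κ (i , j) · τ (i , j) I))
      ≋⇒∃ {n} {k} {v} {f} (mk≋ κ eq) = κ , λ I → begin
        ∑′ n (f I) − ((t ↑ k) · v)                    ≈⟨ ⊖≈− _ _ ⟨
        ∑′ n (f I) ⊖ ((t ↑ k) · v)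
          ≈⟨ +-cong (∑≈∑′ n (f I)) (-‿cong (trans (*-congʳ (^≈↑ t k)) (⊛≈· _ v))) ⟨
        ∑[ i < n ] f I i ⊖ t ^ k ⊛ v                  ≈⟨ eq I ⟩
        ∑[ i < suc a ] ∑[ j < suc b ] (κ (i , j) ⊛ τ (i , j) I)
          ≈⟨ sum-cong-≋ {suc a} (λ i →
               trans (sum-cong-≋ {suc b} (λ j → ⊛≈· (κ (i , j)) (τ (i , j) I)))
                     (∑≈∑′ (suc b) (λ j → κ (i , j) · τ (i , j) I))) ⟩
        ∑[ i < suc a ] ∑′ (suc b) (λ j → κ (i , j) · τ (i , j) I)
          ≈⟨ ∑≈∑′ (suc a) (λ i → ∑′ (suc b) (λ j → κ (i , j) · τ (i , j) I)) ⟩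
        ∑′ (suc a) (λ i → ∑′ (suc b) (λ j → κ (i , j) · τ (i , j) I)) ∎
        where open SetoidReasoning setoid

      row-sum : ∀ {v} → N (suc b) · w ≈ v → ∀ i →
        ∃ λ (κ : Fin (suc a) × Fin (suc b) → Carrier) → ∀ I →
          ∑′ (suc b) (λ j → T⁻ (i , j) I) − const ((t ↑ (a ∸ toℕ i)) · v) I ≈
          ∑′ (suc a) (λ i → ∑′ (suc b) (λ j → κ (i , j) · τ (i , j) I))
      row-sum Nw≈v i = ≋⇒∃ {f = λ I j → T⁻ (i , j) I} (row⁻≋ Nw≈v i)

      column-sum : ∀ {v} → N (suc a) · w ≈ v → ∀ j →
        ∃ λ (κ : Fin (suc a) × Fin (suc b) → Carrier) → ∀ I →
          ∑′ (suc a) (λ i → T⁻ (i , j) I) − const ((t ↑ (b ∸ toℕ j)) · v) I ≈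
          ∑′ (suc a) (λ i → ∑′ (suc b) (λ j → κ (i , j) · τ (i , j) I))
      column-sum Nw≈v j = ≋⇒∃ {f = λ I i → T⁻ (i , j) I} (column⁻≋ Nw≈v j)

-- The Boolean array of an order ideal.

module IdealArrays (a b : ℕ) (I : OrderIdeal [ a ]×[ b ]) where
  open OrderIdeal I
  open Toggleability a b using (minimal?; maximal?)

  -- Beyond the adjoined borders this is the down-closure of the ideal in the whole quadrant.
  -- Indices outside the rectangle need no separate case, monotonicity is transitivity of `≤`, and a
  -- finite search decides it.
  Inside : ℕ → ℕ → Set
  Inside s t = (s ≡ 0 ⊎ t ≡ 0) ⊎
               ∃₂ λ i j → member (i , j) × s ℕ.≤ suc (toℕ i) × t ℕ.≤ suc (toℕ j)

  inside? : ∀ s t → Dec (Inside s t)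
  inside? s t = ((s ℕ.≟ 0) ⊎-dec (t ℕ.≟ 0)) ⊎-dec
    Fin.any? λ i → Fin.any? λ j →
      member? (i , j) ×-dec (s ℕ.≤? suc (toℕ i)) ×-dec (t ℕ.≤? suc (toℕ j))

  array : ℕ → ℕ → Bool
  array s t = does (inside? s t)

  inside-closed : ∀ {s s′ t t′} → s ℕ.≤ s′ → t ℕ.≤ t′ → Inside s′ t′ → Inside s t
  inside-closed s≤ t≤ (inj₁ (inj₁ ≡.refl)) = inj₁ (inj₁ (ℕ.n≤0⇒n≡0 s≤))
  inside-closed s≤ t≤ (inj₁ (inj₂ ≡.refl)) = inj₁ (inj₂ (ℕ.n≤0⇒n≡0 t≤))
  inside-closed s≤ t≤ (inj₂ (i , j , ij∈I , s′≤ , t′≤)) =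
    inj₂ (i , j , ij∈I , ℕ.≤-trans s≤ s′≤ , ℕ.≤-trans t≤ t′≤)

  member⇒inside : ∀ {i j} → member (i , j) → Inside (suc (toℕ i)) (suc (toℕ j))
  member⇒inside ij∈I = inj₂ (_ , _ , ij∈I , ℕ.≤-refl , ℕ.≤-refl)

  -- The witness may be a larger cell; closure of the ideal brings membership down to `(i , j)`.
  inside⇒member : ∀ {i j} → Inside (suc (toℕ i)) (suc (toℕ j)) → member (i , j)
  inside⇒member (inj₁ (inj₁ ()))
  inside⇒member (inj₁ (inj₂ ()))
  inside⇒member (inj₂ (_ , _ , p∈I , i≤ , j≤)) = closed (ℕ.s≤s⁻¹ i≤ , ℕ.s≤s⁻¹ j≤) p∈I

  outside-right : ∀ s → ¬ Inside (suc s) (suc b)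
  outside-right s (inj₁ (inj₁ ()))
  outside-right s (inj₁ (inj₂ ()))
  outside-right s (inj₂ (i , j , _ , _ , b<)) = ℕ.<⇒≱ (Fin.toℕ<n j) (ℕ.s≤s⁻¹ b<)

  outside-below : ∀ t → ¬ Inside (suc a) (suc t)
  outside-below t (inj₁ (inj₁ ()))
  outside-below t (inj₁ (inj₂ ()))
  outside-below t (inj₂ (i , j , _ , a< , _)) = ℕ.<⇒≱ (Fin.toℕ<n i) (ℕ.s≤s⁻¹ a<)

  private
    does-mono : ∀ {A B : Set} → (A → B) → (A? : Dec A) (B? : Dec B) → does A? Bool.≤ does B?
    does-mono f (yes a) (yes b) = b≤b
    does-mono f (yes a) (no ¬b) = contradiction (f a) ¬b
    does-mono f (no ¬a) (yes b) = f≤t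
    does-mono f (no ¬a) (no ¬b) = b≤b

  array-isIdealArray : IsIdealArray a b array
  array-isIdealArray = record
    { decreasingʳ = λ s t → does-mono (inside-closed {s} ℕ.≤-refl (ℕ.n≤1+n t)) (inside? s (suc t)) (inside? s t)
    ; decreasingˡ = λ s t → does-mono (inside-closed {t = t} (ℕ.n≤1+n s) ℕ.≤-refl) (inside? (suc s) t) (inside? s t)
    ; row₀        = λ t → dec-true (inside? 0 t) (inj₁ (inj₁ ≡.refl))
    ; column₀     = λ s → dec-true (inside? s 0) (inj₁ (inj₂ ≡.refl))
    ; right       = λ s → dec-false (inside? (suc s) (suc b)) (outside-right s)
    ; below       = λ t → dec-false (inside? (suc a) (suc t)) (outside-below t) }

  -- Two neighbours suffice: a member strictly above `(i , j)` is larger in some coordinate and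
  -- hence puts the neighbour in that direction inside.
  maximal⇔ : ∀ i j → Maximal [ a ]×[ b ] member (i , j) ⇔
    (Inside (suc (toℕ i)) (suc (toℕ j)) ×
     ¬ Inside (suc (suc (toℕ i))) (suc (toℕ j)) × ¬ Inside (suc (toℕ i)) (suc (suc (toℕ j))))
  maximal⇔ i j = mk⇔ to from
    where
    to : Maximal [ a ]×[ b ] member (i , j) → _
    to (ij∈I , max) = member⇒inside ij∈I , below , right
      where
      below : ¬ Inside (suc (suc (toℕ i))) (suc (toℕ j))
      below (inj₁ (inj₁ ()))
      below (inj₁ (inj₂ ()))
      below (inj₂ (i′ , j′ , p∈I , i< , j≤)) =
        Fin.<⇒≢ (ℕ.s≤s⁻¹ i<) (proj₁ (max _ p∈I (ℕ.<⇒≤ (ℕ.s≤s⁻¹ i<) , ℕ.s≤s⁻¹ j≤)))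
      right : ¬ Inside (suc (toℕ i)) (suc (suc (toℕ j)))
      right (inj₁ (inj₁ ()))
      right (inj₁ (inj₂ ()))
      right (inj₂ (i′ , j′ , p∈I , i≤ , j<)) =
        Fin.<⇒≢ (ℕ.s≤s⁻¹ j<) (proj₂ (max _ p∈I (ℕ.s≤s⁻¹ i≤ , ℕ.<⇒≤ (ℕ.s≤s⁻¹ j<))))
    from : _ → Maximal [ a ]×[ b ] member (i , j)
    from (ij , ¬below , ¬right) = inside⇒member ij , λ (i′ , j′) p∈I (i≤ , j≤) →
      Fin.≤-antisym i≤ (ℕ.≮⇒≥ λ i< → ¬below (inj₂ (i′ , j′ , p∈I , ℕ.s≤s i< , ℕ.s≤s j≤))) ,
      Fin.≤-antisym j≤ (ℕ.≮⇒≥ λ j< → ¬right (inj₂ (i′ , j′ , p∈I , ℕ.s≤s i≤ , ℕ.s≤s j<)))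

  -- Dually, a cell strictly below `(i , j)` lies weakly below one of its two lower neighbours, so
  -- it is a member once both of these are inside.
  minimal⇔ : ∀ i j → Minimal [ a ]×[ b ] (∁ member) (i , j) ⇔
    (¬ Inside (suc (toℕ i)) (suc (toℕ j)) ×
     Inside (toℕ i) (suc (toℕ j)) × Inside (suc (toℕ i)) (toℕ j))
  minimal⇔ i j = mk⇔ to from
    where
    above : ∀ i → (∀ r → ¬ member r → (proj₁ r Fin.≤ i × proj₂ r Fin.≤ j) → (proj₁ r ≡ i × proj₂ r ≡ j)) →
            Inside (toℕ i) (suc (toℕ j))
    -- The first row borders on the adjoined row 0; the predecessor of any other row is `inject₁ i`.
    above zero    min = inj₁ (inj₁ ≡.refl)
    above (suc i) min = inj₂ (inject₁ i , j ,
      -- Minimality only refutes that the neighbour is a nonmember; decidability of the ideal yields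
      -- membership.
      decidable-stable (member? (inject₁ i , j)) (λ p∉I →
        Fin.<⇒≢ (s≤s (ℕ.≤-reflexive (Fin.toℕ-inject₁ i)))
          (proj₁ (min (inject₁ i , j) p∉I (ℕ.m≤n⇒m≤1+n (ℕ.≤-reflexive (Fin.toℕ-inject₁ i)) , ℕ.≤-refl)))) ,
      s≤s (ℕ.≤-reflexive (≡.sym (Fin.toℕ-inject₁ i))) , ℕ.≤-refl)
    left : ∀ j → (∀ r → ¬ member r → (proj₁ r Fin.≤ i × proj₂ r Fin.≤ j) → (proj₁ r ≡ i × proj₂ r ≡ j)) →
           Inside (suc (toℕ i)) (toℕ j)
    left zero    min = inj₁ (inj₂ ≡.refl)
    left (suc j) min = inj₂ (i , inject₁ j ,
      decidable-stable (member? (i , inject₁ j)) (λ p∉I →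
        Fin.<⇒≢ (s≤s (ℕ.≤-reflexive (Fin.toℕ-inject₁ j)))
          (proj₂ (min (i , inject₁ j) p∉I (ℕ.≤-refl , ℕ.m≤n⇒m≤1+n (ℕ.≤-reflexive (Fin.toℕ-inject₁ j)))))) ,
      ℕ.≤-refl , s≤s (ℕ.≤-reflexive (≡.sym (Fin.toℕ-inject₁ j))))
    to : Minimal [ a ]×[ b ] (∁ member) (i , j) → _
    to (ij∉I , min) = ij∉I ∘ inside⇒member , above i min , left j min
    from : _ → Minimal [ a ]×[ b ] (∁ member) (i , j)
    from (¬ij , abv , lft) = ¬ij ∘ member⇒inside , λ (i′ , j′) p∉I (i≤ , j≤) →
      Fin.≤-antisym i≤ (ℕ.≮⇒≥ λ i< → p∉I (inside⇒member (inside-closed i< (s≤s j≤) abv))) ,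
      Fin.≤-antisym j≤ (ℕ.≮⇒≥ λ j< → p∉I (inside⇒member (inside-closed (s≤s i≤) j< lft)))

  -- The decision of the local criterion computes to the conjunction defining `removable`.
  removable-correct : ∀ i j → does (maximal? member? (i , j)) ≡ removable array (toℕ i) (toℕ j)
  removable-correct i j = does-⇔ (maximal⇔ i j) (maximal? member? (i , j))
    (inside? (suc (toℕ i)) (suc (toℕ j)) ×-dec
     ¬? (inside? (suc (suc (toℕ i))) (suc (toℕ j))) ×-dec ¬? (inside? (suc (toℕ i)) (suc (suc (toℕ j)))))

  addable-correct : ∀ i j → does (minimal? {∁ member} (¬? ∘ member?) (i , j)) ≡ addable array (toℕ i) (toℕ j)
  addable-correct i j = does-⇔ (minimal⇔ i j) (minimal? {∁ member} (¬? ∘ member?) (i , j))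
    (¬? (inside? (suc (toℕ i)) (suc (toℕ j))) ×-dec
     inside? (toℕ i) (suc (toℕ j)) ×-dec inside? (suc (toℕ i)) (toℕ j))

-- Lists of ones as geometric sums in K(q).

module PolynomialGeometricSums {c ℓ₁ ℓ₂ : Level} (K : HeytingField c ℓ₁ ℓ₂) where
  open Polynomials K
  open RationalFunctions K
  open GeometricSums rationalFunctionRing (fromPoly X) using (geometric; geometric-unique)
  private
    module A = HeytingField K
    module P = CommutativeRing polynomialRing
    module F = CommutativeRing rationalFunctionRing

  1+X* : ∀ p → 1ₚ +ₚ X *ₚ p ≈ₚ A.1# ∷ p
  1+X* p = mk≈ₚ λ n → A.trans (coeff-+ 1ₚ (X *ₚ p) n) (shift n)
    where
    -- Multiplying by `X` leaves a summand `0# · p`, a list of zeros rather than the empty list, so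
    -- it is removed coefficient by coefficient.
    coeff-X* : ∀ n → coeff (X *ₚ p) n A.≈ coeff (A.0# ∷ 1ₚ *ₚ p) n
    coeff-X* n = A.trans (coeff-+ (A.0# · p) (A.0# ∷ 1ₚ *ₚ p) n)
      (A.trans (A.+-congʳ (A.trans (coeff-· A.0# p n) (A.zeroˡ _))) (A.+-identityˡ _))
    shift : ∀ n → coeff 1ₚ n A.+ coeff (X *ₚ p) n A.≈ coeff (A.1# ∷ p) n
    shift zero    = A.trans (A.+-congˡ (coeff-X* 0)) (A.+-identityʳ A.1#)
    shift (suc n) = A.trans (A.+-identityˡ _) (A.trans (coeff-X* (suc n)) (_≈ₚ_.at (P.*-identityˡ p) n))

  -- All denominators are products of `1ₚ`; once they are cleared, `1+X*` remains.
  fromPoly-1∷ : ∀ p → fromPoly (A.1# ∷ p) F.≈ F.1# F.+ fromPoly X F.* fromPoly p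
  fromPoly-1∷ p = mk≃ (begin
    (A.1# ∷ p) *ₚ (1ₚ *ₚ (1ₚ *ₚ 1ₚ))
      ≈⟨ P.*-congˡ {A.1# ∷ p} (P.trans (P.*-identityˡ (1ₚ *ₚ 1ₚ)) (P.*-identityˡ 1ₚ)) ⟩
    (A.1# ∷ p) *ₚ 1ₚ
      ≈⟨ P.*-congʳ (1+X* p) ⟨
    (1ₚ +ₚ X *ₚ p) *ₚ 1ₚ
      ≈⟨ P.*-congʳ (P.+-cong
           (P.trans (P.*-congˡ {1ₚ} (P.*-identityˡ 1ₚ)) (P.*-identityʳ 1ₚ))
           (P.*-identityʳ (X *ₚ p))) ⟨
    (1ₚ *ₚ (1ₚ *ₚ 1ₚ) +ₚ (X *ₚ p) *ₚ 1ₚ) *ₚ 1ₚ ∎)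
    where open SetoidReasoning P.setoid

  ones : ℕ → Poly
  ones m = replicate m A.1#

  fromPoly-ones : ∀ m → fromPoly (ones m) F.≈ geometric m
  fromPoly-ones = geometric-unique (λ m → fromPoly (ones m)) F.refl (λ m → mk≃ (fromPoly-1∷ (ones m) ._≃_.cross))

  fromPoly*1/ : ∀ p r {{_ : Nonzero r}} → fromPoly p F.* (1ₚ / r) F.≈ p / r
  fromPoly*1/ p r = mk≃ (P.*-cong (P.*-identityʳ p) (P.sym (P.*-identityˡ r)))

  fromPoly*1/≈1 : ∀ r {{_ : Nonzero r}} → fromPoly r F.* (1ₚ / r) F.≈ F.1#
  fromPoly*1/≈1 r = mk≃ (P.trans (P.*-comm (r *ₚ 1ₚ) 1ₚ) (P.*-congˡ {1ₚ} (P.*-comm r 1ₚ)))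

open ℝ⟨q⟩ using (_^_; sum-syntax)
open Defs using (fromPoly; _/_)

-- Specialisation to ℝ(q) and the rectangle.

module RectangleToggles (a b : ℕ) where
  open Toggleability (suc a) (suc b)
  open Polynomials Reals.ℝ-heytingField using (1ₚ; polynomialRing)
  open RationalFunctions Reals.ℝ-heytingField using (mk≃; module _≃_)
  open PolynomialGeometricSums Reals.ℝ-heytingField using (fromPoly-ones; fromPoly*1/; fromPoly*1/≈1)
  open IdealArrays (suc a) (suc b) using (array; array-isIdealArray; addable-correct; removable-correct)
  open CommutativeRing polynomialRing using (refl)
  open BooleanArrays ℝ⟨q⟩ using (⟦_⟧)

  open ToggleSums.Relations ℝ⟨q⟩ ℝ⟨q⟩._-_ ℝ⟨q⟩._*_ _^_ sum-syntax
    -- Both copies of each operation coincide here, so every comparison is reflexivity after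
    -- cross-multiplication.
    (λ x y → mk≃ refl) (λ x y → mk≃ refl) (λ x n → mk≃ refl) (λ n f → mk≃ refl)
    q array array-isIdealArray T⁺ T⁻ Tq
    (λ i j I → ≡.cong ⟦_⟧ (addable-correct I i j)) (λ i j I → ≡.cong ⟦_⟧ (removable-correct I i j))
    (λ p I → mk≃ refl)

  -- Rebuilding an equation with mk≃ compares numerators and denominators only, not
  -- the proofs that the denominators are nonzero.
  rows : ∀ i → (λ I → ∑[ j < suc b ] T⁻ (i , j) I) ≡q
               const (q ^ (a ∸ toℕ i) ℝ⟨q⟩.* ([ suc b ]q / [ suc a + suc b ]q))
  rows i = proj₁ r , λ I → mk≃ (proj₂ r I ._≃_.cross)
    where
    r = row-sum {λ n → fromPoly [ n ]q} (λ n → mk≃ (fromPoly-ones n ._≃_.cross))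
                {1ₚ / [ suc a + suc b ]q} (mk≃ (fromPoly*1/≈1 [ suc a + suc b ]q ._≃_.cross))
                {[ suc b ]q / [ suc a + suc b ]q} (mk≃ (fromPoly*1/ [ suc b ]q [ suc a + suc b ]q ._≃_.cross)) i

  columns : ∀ j → (λ I → ∑[ i < suc a ] T⁻ (i , j) I) ≡q
                  const (q ^ (b ∸ toℕ j) ℝ⟨q⟩.* ([ suc a ]q / [ suc a + suc b ]q))
  columns j = proj₁ r , λ I → mk≃ (proj₂ r I ._≃_.cross)
    where
    r = column-sum {λ n → fromPoly [ n ]q} (λ n → mk≃ (fromPoly-ones n ._≃_.cross))
                   {1ₚ / [ suc a + suc b ]q} (mk≃ (fromPoly*1/≈1 [ suc a + suc b ]q ._≃_.cross))
                   {[ suc a ]q / [ suc a + suc b ]q} (mk≃ (fromPoly*1/ [ suc a ]q [ suc a + suc b ]q ._≃_.cross)) j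

theorem5p12 : (a b : ℕ) .{{_ : NonZero a}} .{{_ : NonZero b}} →
    let open Toggleability a b in
    ((i : Fin a) →
    (λ I → ∑[ j < b ] T⁻ (i , j) I) ≡q
    const (q ^ (a ∸ suc (toℕ i)) ℝ⟨q⟩.* ([ b ]q / [ a + b ]q)))
    ×
    ((j : Fin b) →
    (λ I → ∑[ i < a ] T⁻ (i , j) I) ≡q
    const (q ^ (b ∸ suc (toℕ j)) ℝ⟨q⟩.* ([ a ]q / [ a + b ]q)))
-- With the sides written as successors, `suc a ∸ suc (toℕ i)` computes to the exponent `a ∸ toℕ i`
-- of `rows`, and likewise for `columns`.
theorem5p12 (suc a) (suc b) =
  (λ i → proj₁ (rows i) , λ I → mk≃ (proj₂ (rows i) I ._≃_.cross)) ,
  (λ j → proj₁ (columns j) , λ I → mk≃ (proj₂ (columns j) I ._≃_.cross))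
  where
  open RationalFunctions Reals.ℝ-heytingField using (mk≃; module _≃_)
  open RectangleToggles a b
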